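{- Let $G$ be a finite simple connected walk-regular graph. For all pairs of vertices $u,v$ (with $u\neq v$) and $w,z$ (with $w\ne z$) of $G$, the following statements are equivalent: (a) $\operatorname{sp}(G-u-v)=\operatorname{sp}(G-w-z)$. (b) $\operatorname{sp}(G+uu+vv)=\operatorname{sp}(G+ww+zz)$. (c) $\operatorname{sp}(G+u\bar u+v\bar v)=\operatorname{sp}(G+w\bar w+z\bar z)$.
   Context: $\operatorname{sp}$ denotes the spectrum (eigenvalues with multiplicities) of the adjacency matrix of a graph or pseudograph (a graph possibly with loops and multiple edges). A graph with adjacency matrix $A$ is walk-regular if for every $\ell\ge 0$ the number $(A^\ell)_{uu}$ of closed walks of length $\ell$ at $u$ does not depend on the vertex $u$. $G-u-v$ is the graph obtained from $G$ by removing the vertices $u,v$ and all edges incident to them. $G+uu+vv$ is the pseudograph obtained by adding a loop at $u$ and a loop at $v$, so that its adjacency matrix is $A$ with the $uu$- and $vv$-entries changed to $1$. $G+u\bar u+v\bar v$ is the graph obtained by adding two new vertices $\bar u,\bar v$, with $\bar u$ adjacent only to $u$ and $\bar v$ adjacent only to $v$. -}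

module Defs where

open import Algebra.Apartness.Bundles using (HeytingCommutativeRing; HeytingField)
open import Algebra.Bundles using (CommutativeRing)
open import Algebra.Bundles.Raw using (RawSemiring; RawRing)
import Algebra.Definitions.RawSemiring as RawSemiringDefs
open import Data.Bool.Base using (Bool; true; false; if_then_else_; _∧_)
open import Data.Bool.Properties using (∧-comm)
open import Data.Fin.Base using (Fin; zero; suc; toℕ; punchIn; punchOut)
open import Data.Fin.Properties using (_≟_)
open import Data.List.Base using (List; []; _∷_; [_]; _++_; map; foldr)
import Data.List.Relation.Binary.Permutation.Setoid as Permutation
import Data.Nat.Base as ℕ
open import Data.Nat.Base using (ℕ; zero; suc; pred)
open import Data.Product.Base using (∃; ∃₂; _×_)
open import Level using (_⊔_) renaming (suc to lsuc)
open import Relation.Binary.Construct.Closure.ReflexiveTransitive using (Star)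
open import Relation.Binary.PropositionalEquality using (_≡_; _≢_; refl; cong; cong₂)
open import Relation.Nullary.Decidable using (does)

Matrix : ∀ {a} → Set a → ℕ → Set a
Matrix A n = Fin n → Fin n → A

module MatrixPower {c ℓ} (R : RawSemiring c ℓ) where
  open RawSemiring R
  open RawSemiringDefs R using (sum)

  𝟙 : ∀ {n} → Matrix Carrier n
  𝟙 i j = if does (i ≟ j) then 1# else 0#

  infixl 7 _⊗_
  _⊗_ : ∀ {n} → Matrix Carrier n → Matrix Carrier n → Matrix Carrier n
  (M ⊗ N) i k = sum (λ j → M i j * N j k)

  infixr 8 _^_
  _^_ : ∀ {n} → Matrix Carrier n → ℕ → Matrix Carrier n
  M ^ zero  = 𝟙
  M ^ suc k = M ⊗ (M ^ k)

module Determinant {c ℓ} (R : RawRing c ℓ) where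
  open RawRing R
  open RawSemiringDefs rawSemiring using (sum; _^_)

  minor : ∀ {n} → Matrix Carrier (suc n) → Fin (suc n) → Fin (suc n) → Matrix Carrier n
  minor M i j k l = M (punchIn i k) (punchIn j l)

  -- Laplace expansion along the first row.
  det : ∀ {n} → Matrix Carrier n → Carrier
  det {zero}  M = 1#
  det {suc n} M = sum (λ j → (- 1#) ^ toℕ j * (M zero j * det (minor M zero j)))

-- A polynomial is its list of coefficients, constant term first.  Trailing
-- zeros are allowed, so equality is coefficientwise.
module Polynomial {c ℓ} (R : RawRing c ℓ) where
  open RawRing R

  Poly : Set c
  Poly = List Carrier

  coeff : Poly → ℕ → Carrier
  coeff []      k       = 0#
  coeff (a ∷ p) zero    = a
  coeff (a ∷ p) (suc k) = coeff p k

  infix 4 _≈ₚ_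
  _≈ₚ_ : Poly → Poly → Set ℓ
  p ≈ₚ q = ∀ k → coeff p k ≈ coeff q k

  infixl 6 _+ₚ_
  _+ₚ_ : Poly → Poly → Poly
  []      +ₚ q       = q
  (a ∷ p) +ₚ []      = a ∷ p
  (a ∷ p) +ₚ (b ∷ q) = (a + b) ∷ (p +ₚ q)

  infixl 7 _*ₚ_
  _*ₚ_ : Poly → Poly → Poly
  []      *ₚ q = []
  (a ∷ p) *ₚ q = map (a *_) q +ₚ (0# ∷ (p *ₚ q))

  polyRawRing : RawRing c ℓ
  polyRawRing = record
    { Carrier = Poly
    ; _≈_     = _≈ₚ_
    ; _+_     = _+ₚ_
    ; _*_     = _*ₚ_
    ; -_      = map -_
    ; 0#      = []
    ; 1#      = [ 1# ]
    }

  eval : Poly → Carrier → Carrier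
  eval p x = foldr (λ a y → a + x * y) 0# p

  ∏[X-_] : List Carrier → Poly
  ∏[X- λs ] = foldr (λ r p → (- r ∷ 1# ∷ []) *ₚ p) [ 1# ] λs

  -- det (x I − M)
  charPoly : ∀ {n} → Matrix Carrier n → Poly
  charPoly M = Determinant.det polyRawRing λ i j →
    if does (i ≟ j) then - M i j ∷ 1# ∷ [] else [ - M i j ]

-- Eigenvalues live here: this stands in for ℂ, which the library does not
-- provide.  The base is a Heyting field, so neither equality nor apartness is
-- assumed decidable.
record AlgClosedFieldChar0 c ℓ₁ ℓ₂ : Set (lsuc (c ⊔ ℓ₁ ⊔ ℓ₂)) where
  field
    heytingField : HeytingField c ℓ₁ ℓ₂

  open HeytingField heytingField public

  commutativeRing : CommutativeRing c ℓ₁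
  commutativeRing = HeytingCommutativeRing.commutativeRing heytingCommutativeRing

  open CommutativeRing commutativeRing public using (rawRing)
  open RawSemiringDefs (RawRing.rawSemiring rawRing) public using () renaming (_×_ to _·_)
  open Polynomial rawRing public

  field
    char0     : ∀ n → (suc n · 1#) # 0#
    -- (a ∷ as) ++ [ 1# ] is an arbitrary monic polynomial of positive degree.
    algClosed : ∀ a as → ∃ λ x → eval ((a ∷ as) ++ [ 1# ]) x ≈ 0#

record Pseudograph (n : ℕ) : Set where
  field
    mult     : Matrix ℕ n
    mult-sym : ∀ i j → mult i j ≡ mult j i

record Graph (n : ℕ) : Set where
  field
    adj        : Matrix Bool n
    adj-sym    : ∀ i j → adj i j ≡ adj j i
    adj-irrefl : ∀ i → adj i i ≡ false

open Pseudograph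
open Graph

⟦_⟧ : ∀ {n} → Graph n → Pseudograph n
⟦ G ⟧ .mult i j     = if adj G i j then 1 else 0
⟦ G ⟧ .mult-sym i j = cong (if_then 1 else 0) (adj-sym G i j)

Connected : ∀ {n} → Graph n → Set
Connected G = ∀ u v → Star (λ i j → adj G i j ≡ true) u v

WalkRegular : ∀ {n} → Graph n → Set
WalkRegular G = ∀ ℓ u v → (mult ⟦ G ⟧ ^ ℓ) u u ≡ (mult ⟦ G ⟧ ^ ℓ) v v
  where open MatrixPower ℕ.+-*-rawSemiring using (_^_)

infixl 6 _∖_ _+loop_ _+pendant_

_∖_ : ∀ {n} → Graph n → Fin n → Graph (pred n)
_∖_ {suc n} G u = record
  { adj        = λ i j → adj G (punchIn u i) (punchIn u j)
  ; adj-sym    = λ i j → adj-sym G (punchIn u i) (punchIn u j)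
  ; adj-irrefl = λ i → adj-irrefl G (punchIn u i)
  }

-- G − u − v; after u is deleted, the vertex v is numbered punchOut u≢v.
delete₂ : ∀ {n} → Graph n → (u v : Fin n) → u ≢ v → Graph (pred (pred n))
delete₂ {suc n} G u v u≢v = G ∖ u ∖ punchOut u≢v

_+loop_ : ∀ {n} → Pseudograph n → Fin n → Pseudograph n
(P +loop u) .mult i j =
  mult P i j ℕ.+ (if does (i ≟ u) ∧ does (j ≟ u) then 1 else 0)
(P +loop u) .mult-sym i j =
  cong₂ ℕ._+_ (mult-sym P i j)
    (cong (if_then 1 else 0) (∧-comm (does (i ≟ u)) (does (j ≟ u))))

addLoops₂ : ∀ {n} → Graph n → (u v : Fin n) → Pseudograph n
addLoops₂ G u v = ⟦ G ⟧ +loop u +loop v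

-- The new vertex is zero; an old vertex i becomes suc i.
_+pendant_ : ∀ {n} → Graph n → Fin n → Graph (suc n)
_+pendant_ {n} G u = record { adj = a ; adj-sym = s ; adj-irrefl = r }
  where
  a : Matrix Bool (suc n)
  a zero    zero    = false
  a zero    (suc j) = does (j ≟ u)
  a (suc i) zero    = does (i ≟ u)
  a (suc i) (suc j) = adj G i j

  s : ∀ i j → a i j ≡ a j i
  s zero    zero    = refl
  s zero    (suc j) = refl
  s (suc i) zero    = refl
  s (suc i) (suc j) = adj-sym G i j

  r : ∀ i → a i i ≡ false
  r zero    = refl
  r (suc i) = adj-irrefl G i

addPendants₂ : ∀ {n} → Graph n → (u v : Fin n) → Graph (suc (suc n))
addPendants₂ G u v = G +pendant u +pendant suc v

module Spectrum {c ℓ₁ ℓ₂} (K : AlgClosedFieldChar0 c ℓ₁ ℓ₂) where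
  open AlgClosedFieldChar0 K
  open Permutation setoid using (_↭_)

  -- λs lists the eigenvalues of the adjacency matrix of P, each repeated
  -- according to its (algebraic) multiplicity.
  IsSpectrum : ∀ {n} → Pseudograph n → List Carrier → Set ℓ₁
  IsSpectrum P λs = charPoly (λ i j → mult P i j · 1#) ≈ₚ ∏[X- λs ]

  -- sp(P) = sp(Q) as multisets.  Enumerations exist since K is algebraically
  -- closed.  Only some pair is required to match: without decidable equality on
  -- K, two enumerations of one spectrum need not be provably permutations of
  -- each other.
  SameSpectrum : ∀ {m n} → Pseudograph m → Pseudograph n → Set (c ⊔ ℓ₁)
  SameSpectrum P Q =
    ∃₂ λ λs μs → IsSpectrum P λs × IsSpectrum Q μs × λs ↭ μs

{-# OPTIONS --safe #-}
module Submission where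

-- Let M = x I − A and φ = det M, and write φ⟨S⟩ for the determinant of M with the
-- rows and columns in S removed.  Adding loops at u and v changes φ into
-- φ − φ⟨u⟩ − φ⟨v⟩ + φ⟨uv⟩, and adding pendant vertices changes it into
-- x² φ − x φ⟨u⟩ − x φ⟨v⟩ + φ⟨uv⟩, so it suffices that φ⟨u⟩ is the same for all u.
-- Since A is symmetric, the cofactor matrix C of M satisfies C M = φ I.  Comparing
-- coefficients of powers of x gives C k = φ (k + 1) I + C (k + 1) A, and C k = 0 for
-- large k.  Hence each C k is a polynomial in A, so by walk-regularity its diagonal,
-- which consists of the coefficients of the φ⟨u⟩, is constant.

open import Algebra.Bundles using (CommutativeRing; RawRing)
import Algebra.Definitions.RawSemiring as RawSemiringDefs
import Algebra.Properties.CommutativeSemigroup as CommutativeSemigroupProperties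
import Algebra.Properties.Ring as RingProperties
import Algebra.Properties.Semiring.Exp as Exp
import Algebra.Properties.Semiring.Mult as Mult
import Algebra.Properties.Semiring.Sum as Sum
open import Data.Bool.Base using (_∧_; false; if_then_else_; true)
open import Data.Fin.Base using (Fin; punchIn; punchOut; suc; toℕ; zero)
open import Data.Fin.Properties using (_≟_; punchIn-injective; punchIn-punchOut; punchInᵢ≢i; punchOut-cong; punchOut-punchIn)
open import Data.List.Base using ([]; [_]; _++_; _∷_; applyUpTo; map)
import Data.List.Relation.Binary.Permutation.Setoid as Permutation
open import Data.List.Relation.Binary.Pointwise.Base using ([]; _∷_)
import Data.Nat.Base as ℕ
open import Data.Nat.Base using (_≤_; suc; s≤s; zero; z≤n; ℕ)
import Data.Nat.Properties as ℕ
open import Data.Product.Base using (_,_; _×_; proj₁; proj₂; ∃)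
open import Defs
open import Function.Base using (_∘_)
open import Function.Bundles using (_⇔_; mk⇔)
open import Function.Construct.Composition using (_⇔-∘_)
open import Function.Construct.Symmetry using (⇔-sym)
import Relation.Binary.PropositionalEquality as ≡
open import Relation.Binary.PropositionalEquality using (_≡_; _≢_)
import Relation.Binary.Reasoning.Setoid as SetoidReasoning
open import Relation.Binary.Structures using (IsEquivalence)
open import Relation.Nullary.Decidable using (dec-false; dec-true; does; no; yes)
open import Relation.Nullary.Negation using (contradiction)

-- The determinant is given by expansion along row zero, whereas the vertices are arbitrary.
-- Expansion along another row is derived by expanding along row zero and that row together: the
-- coefficient of a pair of entries changes sign when their columns are exchanged. This one skew
-- symmetry yields both the general expansion and the vanishing of a determinant with two equal
-- rows. The latter goes by pairwise cancellation and never through D = -D, so it is valid over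
-- every commutative ring, in particular over polynomials.
--
-- Row expansions produce (x I - A) times the transpose of C; the symmetry of A is what replaces the
-- expansion along columns.
--
-- The polynomial in A that represents a coefficient matrix of C is never written down. The
-- induction runs over the diagonals of its products with all powers of A at once.
--
-- A spectrum is a list of roots, and equality of roots cannot be decided. Permuted roots give equal
-- products; conversely, a single factorization is chosen for two equal characteristic polynomials.

punchIn-punchOut-swap : ∀ {n} {j k : Fin (suc (suc n))} (j≢k : j ≢ k) (k≢j : k ≢ j) (l : Fin n) →
  punchIn j (punchIn (punchOut j≢k) l) ≡ punchIn k (punchIn (punchOut k≢j) l)
punchIn-punchOut-swap {_} {zero}  {zero}  j≢k k≢j l       = contradiction ≡.refl j≢k
punchIn-punchOut-swap {_} {zero}  {suc k} j≢k k≢j l       = ≡.refl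
punchIn-punchOut-swap {_} {suc j} {zero}  j≢k k≢j l       = ≡.refl
punchIn-punchOut-swap {_} {suc j} {suc k} j≢k k≢j zero    = ≡.refl
punchIn-punchOut-swap {_} {suc j} {suc k} j≢k k≢j (suc l) =
  ≡.cong suc (punchIn-punchOut-swap (j≢k ∘ ≡.cong suc) (k≢j ∘ ≡.cong suc) l)

does-punchIn : ∀ {n} (u : Fin (suc n)) i j → does (punchIn u i ≟ punchIn u j) ≡ does (i ≟ j)
does-punchIn u i j with i ≟ j
... | yes ≡.refl = dec-true (punchIn u i ≟ punchIn u i) ≡.refl
... | no i≢j     = dec-false (punchIn u i ≟ punchIn u j) (i≢j ∘ punchIn-injective u i j)

does-punchOut : ∀ {n} {v u : Fin (suc n)} (v≢u : v ≢ u) i → does (punchIn v i ≟ u) ≡ does (i ≟ punchOut v≢u)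
does-punchOut {v = v} {u} v≢u i = ≡.trans
  (≡.cong (λ t → does (punchIn v i ≟ t)) (≡.sym (punchIn-punchOut v≢u)))
  (does-punchIn v i (punchOut v≢u))

-- Determinants over a commutative ring, beginning with finite sums

module DeterminantProperties {c ℓ} (R : CommutativeRing c ℓ) where
  open CommutativeRing R hiding (zero)
  open Determinant rawRing
  open RingProperties ring
  open Exp semiring using (_^_; ^-homo-*)
  open Sum semiring
  open SetoidReasoning setoid

  x-[y-z]≈x-y+z : ∀ x y z → x - (y - z) ≈ (x - y) + z
  x-[y-z]≈x-y+z x y z = begin
    x - (y - z)        ≈⟨ +-congˡ (-‿+-comm y (- z)) ⟨
    x + (- y - - z)    ≈⟨ +-congˡ (+-congˡ (-‿involutive z)) ⟩
    x + (- y + z)      ≈⟨ +-assoc _ _ _ ⟨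
    (x - y) + z        ∎

  sum-cong : ∀ {n} {f g : Fin n → Carrier} → (∀ i → f i ≈ g i) → sum f ≈ sum g
  sum-cong = sum-cong-≋

  sum-zero : ∀ {n} {f : Fin n → Carrier} → (∀ i → f i ≈ 0#) → sum f ≈ 0#
  sum-zero {n} f≈0 = trans (sum-cong f≈0) (sum-replicate-zero n)

  sum-neg : ∀ {n} (f : Fin n → Carrier) → sum (λ i → - f i) ≈ - sum f
  sum-neg f = begin
    sum (λ i → - f i)        ≈⟨ sum-cong (λ i → -1*x≈-x (f i)) ⟨
    sum (λ i → - 1# * f i)   ≈⟨ *-distribˡ-sum (- 1#) f ⟨
    - 1# * sum f             ≈⟨ -1*x≈-x _ ⟩
    - sum f                  ∎

  -- A column `j` and a column of the minor without `j` are indexed by sets of different sizes, so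
  -- their sums cannot be interchanged directly. Renumbering the second column as in the full
  -- matrix, with zeros on the diagonal, makes the index set square.
  offDiagonal : ∀ {n} → (Fin (suc n) → Fin n → Carrier) → Matrix Carrier (suc n)
  offDiagonal f j k with j ≟ k
  ... | yes _  = 0#
  ... | no j≢k = f j (punchOut j≢k)

  offDiagonal-diag : ∀ {n} (f : Fin (suc n) → Fin n → Carrier) j → offDiagonal f j j ≈ 0#
  offDiagonal-diag f j with j ≟ j
  ... | yes _  = refl
  ... | no j≢j = contradiction ≡.refl j≢j

  offDiagonal-punchIn : ∀ {n} (f : Fin (suc n) → Fin n → Carrier) j l → offDiagonal f j (punchIn j l) ≈ f j l
  offDiagonal-punchIn f j l with j ≟ punchIn j l
  ... | yes eq = contradiction (≡.sym eq) (punchInᵢ≢i j l)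
  ... | no neq = reflexive (≡.cong (f j) (≡.trans (punchOut-cong j ≡.refl) (punchOut-punchIn j)))

  sum-offDiagonal : ∀ {n} (f : Fin (suc n) → Fin n → Carrier) →
    sum (λ j → sum (f j)) ≈ sum (λ j → sum (offDiagonal f j))
  sum-offDiagonal f = sum-cong λ j → begin
    sum (f j)                                                     ≈⟨ +-identityˡ _ ⟨
    0# + sum (f j)                                                ≈⟨ +-cong (offDiagonal-diag f j) (sum-cong (offDiagonal-punchIn f j)) ⟨
    offDiagonal f j j + sum (λ l → offDiagonal f j (punchIn j l)) ≈⟨ sum-remove {i = j} (offDiagonal f j) ⟨
    sum (offDiagonal f j)                                         ∎

  sum-transpose : ∀ {n} (f g : Fin (suc n) → Fin n → Carrier) →
    (∀ {j k} (j≢k : j ≢ k) (k≢j : k ≢ j) → f j (punchOut j≢k) ≈ g k (punchOut k≢j)) →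
    sum (λ j → sum (f j)) ≈ sum (λ j → sum (g j))
  sum-transpose f g f≈g = begin
    sum (λ j → sum (f j))                           ≈⟨ sum-offDiagonal f ⟩
    sum (λ j → sum (λ k → offDiagonal f j k))       ≈⟨ ∑-comm (offDiagonal f) ⟩
    sum (λ k → sum (λ j → offDiagonal f j k))       ≈⟨ sum-cong (λ k → sum-cong (λ j → transposed j k)) ⟩
    sum (λ k → sum (λ j → offDiagonal g k j))       ≈⟨ sum-offDiagonal g ⟨
    sum (λ k → sum (g k))                           ∎
    where
    transposed : ∀ j k → offDiagonal f j k ≈ offDiagonal g k j
    transposed j k with j ≟ k | k ≟ j
    ... | yes _   | yes _   = refl
    ... | yes j≡k | no k≢j  = contradiction (≡.sym j≡k) k≢j
    ... | no j≢k  | yes k≡j = contradiction (≡.sym k≡j) j≢k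
    ... | no j≢k  | no k≢j  = f≈g j≢k k≢j

  -- Skew symmetry alone would give only that twice the sum is zero, and 2 may fail to be
  -- cancellable. With a zero diagonal, row zero cancels against column zero, and the rest is a
  -- smaller matrix of the same kind.
  sum-skew : ∀ {n} (F : Matrix Carrier n) → (∀ j → F j j ≈ 0#) → (∀ j k → F j k ≈ - F k j) →
    sum (λ j → sum (F j)) ≈ 0#
  sum-skew {zero}  F diag skew = refl
  sum-skew {suc n} F diag skew = begin
    (F zero zero + row) + sum (λ j → F (suc j) zero + sum (F (suc j) ∘ suc))
      ≈⟨ +-cong (trans (+-congʳ (diag zero)) (+-identityˡ _)) (∑-distrib-+ (λ j → F (suc j) zero) (λ j → sum (F (suc j) ∘ suc))) ⟩
    row + (sum (λ j → F (suc j) zero) + sum (λ j → sum (F (suc j) ∘ suc)))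
      ≈⟨ +-congˡ (+-cong (trans (sum-cong (λ j → skew (suc j) zero)) (sum-neg (F zero ∘ suc)))
                         (sum-skew (λ j k → F (suc j) (suc k)) (diag ∘ suc) (λ j k → skew (suc j) (suc k)))) ⟩
    row + (- row + 0#)
      ≈⟨ +-congˡ (+-identityʳ _) ⟩
    row + - row
      ≈⟨ -‿inverseʳ row ⟩
    0# ∎
    where row = sum (F zero ∘ suc)

  sum-offDiagonal-skew : ∀ {n} (f : Fin (suc n) → Fin n → Carrier) →
    (∀ {j k} (j≢k : j ≢ k) (k≢j : k ≢ j) → f j (punchOut j≢k) ≈ - f k (punchOut k≢j)) →
    sum (λ j → sum (f j)) ≈ 0#
  sum-offDiagonal-skew f skew = trans (sum-offDiagonal f) (sum-skew (offDiagonal f) (offDiagonal-diag f) skewed)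
    where
    skewed : ∀ j k → offDiagonal f j k ≈ - offDiagonal f k j
    skewed j k with j ≟ k | k ≟ j
    ... | yes _   | yes _   = sym -0#≈0#
    ... | yes j≡k | no k≢j  = contradiction (≡.sym j≡k) k≢j
    ... | no j≢k  | yes k≡j = contradiction (≡.sym k≡j) j≢k
    ... | no j≢k  | no k≢j  = skew j≢k k≢j

  sum-indicator : ∀ {n} (i : Fin n) (f : Fin n → Carrier) → sum (λ j → if does (j ≟ i) then f j else 0#) ≈ f i
  sum-indicator {suc n} i f = begin
    sum h                                ≈⟨ sum-remove {i = i} h ⟩
    h i + sum (h ∘ punchIn i)            ≈⟨ +-cong on (sum-zero off) ⟩
    f i + 0#                             ≈⟨ +-identityʳ _ ⟩
    f i                                  ∎
    where
    h : Fin (suc n) → Carrier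
    h j = if does (j ≟ i) then f j else 0#
    on : h i ≈ f i
    on = reflexive (≡.cong (λ b → if b then f i else 0#) (dec-true (i ≟ i) ≡.refl))
    off : ∀ l → h (punchIn i l) ≈ 0#
    off l = reflexive (≡.cong (λ b → if b then f (punchIn i l) else 0#)
      (dec-false (punchIn i l ≟ i) (punchInᵢ≢i i l)))

  -- Signs of positions

  sign : ℕ → Carrier
  sign n = (- 1#) ^ n

  sign-suc : ∀ n → sign (suc n) ≈ - sign n
  sign-suc n = -1*x≈-x (sign n)

  sign-2+ : ∀ n → sign (suc (suc n)) ≈ sign n
  sign-2+ n = trans (sign-suc (suc n)) (trans (-‿cong (sign-suc n)) (-‿involutive _))

  sign-double : ∀ n → sign (n ℕ.+ n) ≈ 1#
  sign-double zero    = refl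
  sign-double (suc n) = begin
    sign (suc (n ℕ.+ suc n))   ≡⟨ ≡.cong (sign ∘ suc) (ℕ.+-suc n n) ⟩
    sign (suc (suc (n ℕ.+ n))) ≈⟨ sign-2+ (n ℕ.+ n) ⟩
    sign (n ℕ.+ n)             ≈⟨ sign-double n ⟩
    1#                         ∎

  -- Deleting the smaller of two columns lowers the number of the larger by one; deleting the larger
  -- leaves the smaller in place. The two exponents therefore differ by exactly one.
  sign-punchOut : ∀ {n} {j k : Fin (suc (suc n))} (j≢k : j ≢ k) (k≢j : k ≢ j) →
    sign (toℕ j ℕ.+ toℕ (punchOut j≢k)) ≈ - sign (toℕ k ℕ.+ toℕ (punchOut k≢j))
  sign-punchOut {_} {zero}  {zero}  j≢k k≢j = contradiction ≡.refl j≢k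
  sign-punchOut {_} {zero}  {suc k} j≢k k≢j = begin
    sign (toℕ k)                ≈⟨ -‿involutive _ ⟨
    - - sign (toℕ k)            ≈⟨ -‿cong (sign-suc (toℕ k)) ⟨
    - sign (suc (toℕ k))        ≡⟨ ≡.cong (λ m → - sign (suc m)) (ℕ.+-identityʳ (toℕ k)) ⟨
    - sign (suc (toℕ k ℕ.+ 0))  ∎
  sign-punchOut {_} {suc j} {zero}  j≢k k≢j = begin
    sign (suc (toℕ j ℕ.+ 0))    ≡⟨ ≡.cong (λ m → sign (suc m)) (ℕ.+-identityʳ (toℕ j)) ⟩
    sign (suc (toℕ j))          ≈⟨ sign-suc (toℕ j) ⟩
    - sign (toℕ j)              ∎
  sign-punchOut {zero} {suc zero} {suc zero} j≢k k≢j = contradiction ≡.refl j≢k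
  sign-punchOut {suc _} {suc j} {suc k} j≢k k≢j = begin
    sign (suc (toℕ j ℕ.+ suc (toℕ (punchOut j≢k′))))  ≈⟨ drop₂ (toℕ j) _ ⟩
    sign (toℕ j ℕ.+ toℕ (punchOut j≢k′))              ≈⟨ sign-punchOut j≢k′ k≢j′ ⟩
    - sign (toℕ k ℕ.+ toℕ (punchOut k≢j′))            ≈⟨ -‿cong (drop₂ (toℕ k) _) ⟨
    - sign (suc (toℕ k ℕ.+ suc (toℕ (punchOut k≢j′)))) ∎
    where
    j≢k′ = j≢k ∘ ≡.cong suc
    k≢j′ = k≢j ∘ ≡.cong suc
    drop₂ : ∀ a b → sign (suc (a ℕ.+ suc b)) ≈ sign (a ℕ.+ b)
    drop₂ a b = trans (reflexive (≡.cong (sign ∘ suc) (ℕ.+-suc a b))) (sign-2+ (a ℕ.+ b))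

  -- Laplace expansion and cofactors

  det-cong : ∀ {n} {M N : Matrix Carrier n} → (∀ i j → M i j ≈ N i j) → det M ≈ det N
  det-cong {zero}  M≈N = refl
  det-cong {suc n} M≈N = sum-cong λ j →
    *-congˡ {sign (toℕ j)} (*-cong (M≈N zero j) (det-cong (λ k l → M≈N (suc k) (punchIn j l))))

  cofactor : ∀ {n} → Matrix Carrier (suc n) → Matrix Carrier (suc n)
  cofactor M i j = sign (toℕ i ℕ.+ toℕ j) * det (minor M i j)

  -- In each term of the expansion along row zero, either the entry itself lies in column zero, or
  -- the minor retains that column.
  det-zeroColumn : ∀ {n} (M : Matrix Carrier (suc n)) → (∀ i → M i zero ≈ 0#) → det M ≈ 0#
  det-zeroColumn M M≈0 = sum-zero (vanish M M≈0)
    where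
    vanish : ∀ {n} (M : Matrix Carrier (suc n)) → (∀ i → M i zero ≈ 0#) →
      ∀ j → sign (toℕ j) * (M zero j * det (minor M zero j)) ≈ 0#
    vanish M M≈0 zero = trans (*-congˡ (trans (*-congʳ (M≈0 zero)) (zeroˡ _))) (zeroʳ (sign 0))
    vanish {suc n} M M≈0 (suc j) = trans
      (*-congˡ (trans (*-congˡ (det-zeroColumn (minor M zero (suc j)) (M≈0 ∘ suc))) (zeroʳ _)))
      (zeroʳ _)

  -- The coefficient of M 0 j * M i k (i = suc r, k = punchIn j l) in the expansion of det M along rows 0 and i.
  private
    coeff₂ : ∀ {n} → Matrix Carrier (suc (suc n)) → Fin (suc n) → Fin (suc (suc n)) → Fin (suc n) → Carrier
    coeff₂ M r j l = sign (toℕ r) * (sign (toℕ j ℕ.+ toℕ l) * det (minor (minor M zero j) r l))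

    -- Removing columns `j` and `k` in either order leaves the same matrix, so only the position
    -- sign distinguishes the two coefficients.
    coeff₂-skew : ∀ {n} (M : Matrix Carrier (suc (suc n))) r {j k} (j≢k : j ≢ k) (k≢j : k ≢ j) →
      coeff₂ M r j (punchOut j≢k) ≈ - coeff₂ M r k (punchOut k≢j)
    coeff₂-skew M r {j} {k} j≢k k≢j = begin
      sign (toℕ r) * (sign (toℕ j ℕ.+ toℕ (punchOut j≢k)) * det (minor (minor M zero j) r (punchOut j≢k)))
        ≈⟨ *-congˡ (*-cong (sign-punchOut j≢k k≢j) (det-cong λ a b →
             reflexive (≡.cong (M (suc (punchIn r a))) (punchIn-punchOut-swap j≢k k≢j b)))) ⟩
      sign (toℕ r) * (- sign (toℕ k ℕ.+ toℕ (punchOut k≢j)) * det (minor (minor M zero k) r (punchOut k≢j)))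
        ≈⟨ *-congˡ (-‿distribˡ-* _ _) ⟨
      sign (toℕ r) * - (sign (toℕ k ℕ.+ toℕ (punchOut k≢j)) * det (minor (minor M zero k) r (punchOut k≢j)))
        ≈⟨ -‿distribʳ-* _ _ ⟨
      - coeff₂ M r k (punchOut k≢j) ∎

    x∙yz≈y∙xz : ∀ x y z → x * (y * z) ≈ y * (x * z)
    x∙yz≈y∙xz x y z = trans (sym (*-assoc _ _ _)) (trans (*-congʳ (*-comm x y)) (*-assoc _ _ _))

  mutual
    -- Row `r` of a minor without row zero is row `suc r` of `M`, so `laplace` applies to each
    -- minor. The mutual recursion is founded on the size of the matrix, which drops by one there.
    det-expand₂ : ∀ {n} (M : Matrix Carrier (suc (suc n))) r →
      det M ≈ sum (λ j → sum (λ l → (M zero j * M (suc r) (punchIn j l)) * coeff₂ M r j l))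
    det-expand₂ M r = sum-cong λ j → begin
      sign (toℕ j) * (M zero j * det (minor M zero j))
        ≈⟨ *-congˡ (*-congˡ (laplace (minor M zero j) r)) ⟩
      sign (toℕ j) * (M zero j * sum (λ l → M (suc r) (punchIn j l) * cofactor (minor M zero j) r l))
        ≈⟨ *-congˡ (*-distribˡ-sum (M zero j) (λ l → M (suc r) (punchIn j l) * cofactor (minor M zero j) r l)) ⟩
      sign (toℕ j) * sum (λ l → M zero j * (M (suc r) (punchIn j l) * cofactor (minor M zero j) r l))
        ≈⟨ *-distribˡ-sum (sign (toℕ j)) (λ l → M zero j * (M (suc r) (punchIn j l) * cofactor (minor M zero j) r l)) ⟩
      sum (λ l → sign (toℕ j) * (M zero j * (M (suc r) (punchIn j l) * cofactor (minor M zero j) r l)))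
        ≈⟨ sum-cong (λ l → term j l (M zero j) (M (suc r) (punchIn j l)) (det (minor (minor M zero j) r l))) ⟩
      sum (λ l → (M zero j * M (suc r) (punchIn j l)) * coeff₂ M r j l) ∎
      where
      term : ∀ j l x y d → sign (toℕ j) * (x * (y * (sign (toℕ r ℕ.+ toℕ l) * d))) ≈
        (x * y) * (sign (toℕ r) * (sign (toℕ j ℕ.+ toℕ l) * d))
      term j l x y d = begin
        s * (x * (y * (sign (toℕ r ℕ.+ toℕ l) * d)))  ≈⟨ *-congˡ (*-assoc _ _ _) ⟨
        s * ((x * y) * (sign (toℕ r ℕ.+ toℕ l) * d))  ≈⟨ *-congˡ (*-congˡ (*-congʳ (^-homo-* (- 1#) (toℕ r) (toℕ l)))) ⟩
        s * ((x * y) * ((t * q) * d))                 ≈⟨ *-assoc _ _ _ ⟨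
        (s * (x * y)) * ((t * q) * d)                 ≈⟨ *-cong (*-comm _ _) (*-assoc _ _ _) ⟩
        ((x * y) * s) * (t * (q * d))                 ≈⟨ *-assoc _ _ _ ⟩
        (x * y) * (s * (t * (q * d)))                 ≈⟨ *-congˡ (x∙yz≈y∙xz s t (q * d)) ⟩
        (x * y) * (t * (s * (q * d)))                 ≈⟨ *-congˡ (*-congˡ (*-assoc _ _ _)) ⟨
        (x * y) * (t * ((s * q) * d))                 ≈⟨ *-congˡ (*-congˡ (*-congʳ (^-homo-* (- 1#) (toℕ j) (toℕ l)))) ⟨
        (x * y) * (t * (sign (toℕ j ℕ.+ toℕ l) * d))  ∎
        where
        s = sign (toℕ j)
        t = sign (toℕ r)
        q = sign (toℕ l)

    -- For a row `suc r`, the two-row expansion is summed in the other order: the column of row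
    -- `suc r` becomes the outer index. Skewness supplies the minus sign, and the inner sum is then
    -- the row-zero expansion of the minor that occurs in the cofactor.
    laplace : ∀ {n} (M : Matrix Carrier (suc n)) i → det M ≈ sum (λ j → M i j * cofactor M i j)
    laplace M zero = sum-cong λ j → x∙yz≈y∙xz (sign (toℕ j)) (M zero j) (det (minor M zero j))
    laplace {suc n} M (suc r) = begin
      det M
        ≈⟨ det-expand₂ M r ⟩
      sum (λ j → sum (λ l → (M zero j * M (suc r) (punchIn j l)) * coeff₂ M r j l))
        ≈⟨ sum-transpose (λ j l → (M zero j * M (suc r) (punchIn j l)) * coeff₂ M r j l)
                         (λ k l → M (suc r) k * (M zero (punchIn k l) * - coeff₂ M r k l)) transposed ⟩
      sum (λ k → sum (λ l → M (suc r) k * (M zero (punchIn k l) * - coeff₂ M r k l)))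
        ≈⟨ sum-cong (λ k → trans
             (sym (*-distribˡ-sum (M (suc r) k) (λ l → M zero (punchIn k l) * - coeff₂ M r k l)))
             (*-congˡ {M (suc r) k} (row k))) ⟩
      sum (λ k → M (suc r) k * cofactor M (suc r) k) ∎
      where
      transposed : ∀ {j k} (j≢k : j ≢ k) (k≢j : k ≢ j) →
        (M zero j * M (suc r) (punchIn j (punchOut j≢k))) * coeff₂ M r j (punchOut j≢k) ≈
        M (suc r) k * (M zero (punchIn k (punchOut k≢j)) * - coeff₂ M r k (punchOut k≢j))
      transposed {j} {k} j≢k k≢j
        rewrite punchIn-punchOut j≢k | punchIn-punchOut k≢j =
        trans (*-cong (*-comm _ _) (coeff₂-skew M r j≢k k≢j)) (*-assoc _ _ _)

      -- Row zero stays on top when row `suc r` is deleted, and deleting it afterwards gives, by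
      -- computation, the same matrix as deleting row zero and then row `r`. What remains is
      -- bookkeeping of signs.
      row : ∀ k → sum (λ l → M zero (punchIn k l) * - coeff₂ M r k l) ≈ cofactor M (suc r) k
      row k = sym (trans (*-distribˡ-sum (sign (suc (toℕ r ℕ.+ toℕ k)))
        (λ l → sign (toℕ l) * (M zero (punchIn k l) * det (minor (minor M zero k) r l)))) (sum-cong λ l →
        term l (M zero (punchIn k l)) (det (minor (minor M zero k) r l))))
        where
        term : ∀ (l : Fin (suc n)) x d → sign (suc (toℕ r ℕ.+ toℕ k)) * (sign (toℕ l) * (x * d)) ≈
          x * - (sign (toℕ r) * (sign (toℕ k ℕ.+ toℕ l) * d))
        term l x d = begin
          sign (suc (toℕ r ℕ.+ toℕ k)) * (q * (x * d))  ≈⟨ *-cong (trans (sign-suc (toℕ r ℕ.+ toℕ k)) (-‿cong (^-homo-* (- 1#) (toℕ r) (toℕ k)))) (x∙yz≈y∙xz q x d) ⟩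
          - (t * s) * (x * (q * d))                     ≈⟨ -‿distribˡ-* _ _ ⟨
          - ((t * s) * (x * (q * d)))                   ≈⟨ -‿cong (x∙yz≈y∙xz (t * s) x (q * d)) ⟩
          - (x * ((t * s) * (q * d)))                   ≈⟨ -‿cong (*-congˡ (*-assoc _ _ _)) ⟩
          - (x * (t * (s * (q * d))))                   ≈⟨ -‿cong (*-congˡ (*-congˡ (*-assoc _ _ _))) ⟨
          - (x * (t * ((s * q) * d)))                   ≈⟨ -‿cong (*-congˡ (*-congˡ (*-congʳ (^-homo-* (- 1#) (toℕ k) (toℕ l))))) ⟨
          - (x * (t * (sign (toℕ k ℕ.+ toℕ l) * d)))    ≈⟨ -‿distribʳ-* _ _ ⟩
          x * - (t * (sign (toℕ k ℕ.+ toℕ l) * d))      ∎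
          where
          s = sign (toℕ k)
          t = sign (toℕ r)
          q = sign (toℕ l)

  -- With equal rows, the product of the two entries is symmetric in the two columns while its
  -- coefficient is skew, so the terms of the two-row expansion cancel in pairs.
  det-equalRows₀ : ∀ {n} (M : Matrix Carrier (suc (suc n))) r → (∀ j → M zero j ≈ M (suc r) j) → det M ≈ 0#
  det-equalRows₀ M r eq = trans (det-expand₂ M r) (sum-offDiagonal-skew (λ j l → (M zero j * M (suc r) (punchIn j l)) * coeff₂ M r j l) skew)
    where
    skew : ∀ {j k} (j≢k : j ≢ k) (k≢j : k ≢ j) →
      (M zero j * M (suc r) (punchIn j (punchOut j≢k))) * coeff₂ M r j (punchOut j≢k) ≈
      - ((M zero k * M (suc r) (punchIn k (punchOut k≢j))) * coeff₂ M r k (punchOut k≢j))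
    skew {j} {k} j≢k k≢j rewrite punchIn-punchOut j≢k | punchIn-punchOut k≢j = trans
      (*-cong (trans (*-cong (eq j) (sym (eq k))) (*-comm _ _)) (coeff₂-skew M r j≢k k≢j))
      (sym (-‿distribʳ-* _ _))

  -- If neither row is row zero, both survive in every minor of the row-zero expansion, which
  -- reduces the size.
  det-equalRows : ∀ {n} (M : Matrix Carrier n) {i k} → i ≢ k → (∀ j → M i j ≈ M k j) → det M ≈ 0#
  det-equalRows M {zero} {zero} i≢k eq = contradiction ≡.refl i≢k
  det-equalRows {suc (suc n)} M {zero} {suc k} i≢k eq = det-equalRows₀ M k eq
  det-equalRows {suc (suc n)} M {suc i} {zero} i≢k eq = det-equalRows₀ M i (sym ∘ eq)
  det-equalRows M {suc i} {suc k} i≢k eq = sum-zero λ j → trans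
    (*-congˡ (trans (*-congˡ (det-equalRows (minor M zero j) (i≢k ∘ ≡.cong suc) (λ l → eq (punchIn j l)))) (zeroʳ (M zero j))))
    (zeroʳ (sign (toℕ j)))

  -- The cofactors along row `k` do not see row `k`. Overwriting that row with row `i` turns the sum
  -- into a genuine expansion of a determinant with two equal rows.
  alienCofactors : ∀ {n} (M : Matrix Carrier (suc n)) {i k} → i ≢ k → sum (λ j → M i j * cofactor M k j) ≈ 0#
  alienCofactors {n} M {i} {k} i≢k = begin
    sum (λ j → M i j * cofactor M k j)      ≈⟨ sum-cong (λ j → *-cong (reflexive (≡.sym (rowₖ j)))
                                                   (*-congˡ {sign (toℕ k ℕ.+ toℕ j)} (det-cong (λ a b → reflexive (≡.sym (row≢ₖ a (punchIn j b))))))) ⟩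
    sum (λ j → M′ k j * cofactor M′ k j)    ≈⟨ laplace M′ k ⟨
    det M′                                  ≈⟨ det-equalRows M′ i≢k (λ j → reflexive (≡.trans (rowᵢ j) (≡.sym (rowₖ j)))) ⟩
    0#                                      ∎
    where
    M′ : Matrix Carrier (suc n)
    M′ a b = M (if does (a ≟ k) then i else a) b
    rowₖ : ∀ j → M′ k j ≡ M i j
    rowₖ j = ≡.cong (λ t → M (if t then i else k) j) (dec-true (k ≟ k) ≡.refl)
    rowᵢ : ∀ j → M′ i j ≡ M i j
    rowᵢ j = ≡.cong (λ t → M (if t then i else i) j) (dec-false (i ≟ k) i≢k)
    row≢ₖ : ∀ a j → M′ (punchIn k a) j ≡ M (punchIn k a) j
    row≢ₖ a j = ≡.cong (λ t → M (if t then i else punchIn k a) j) (dec-false (punchIn k a ≟ k) (punchInᵢ≢i k a))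

  -- Changing one entry, and bordering a matrix

  addEntry : ∀ {n} → Matrix Carrier n → Fin n → Fin n → Carrier → Matrix Carrier n
  addEntry M i j c k l = M k l + (if does (k ≟ i) ∧ does (l ≟ j) then c else 0#)

  -- The determinant is linear in row `i`, and the cofactors along that row are unaffected by the
  -- change.
  det-addEntry : ∀ {n} (M : Matrix Carrier (suc n)) i j c →
    det (addEntry M i j c) ≈ det M + c * cofactor M i j
  det-addEntry M i j c = begin
    det (addEntry M i j c)
      ≈⟨ laplace (addEntry M i j c) i ⟩
    sum (λ l → addEntry M i j c i l * cofactor (addEntry M i j c) i l)
      ≈⟨ sum-cong (λ l → *-cong (rowᵢ l) (*-congˡ {sign (toℕ i ℕ.+ toℕ l)} (det-cong (λ a b → row≢ᵢ a (punchIn l b))))) ⟩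
    sum (λ l → (M i l + δ l) * cofactor M i l)
      ≈⟨ sum-cong (λ l → trans (distribʳ (cofactor M i l) (M i l) (δ l)) (+-congˡ (select l))) ⟩
    sum (λ l → M i l * cofactor M i l + (if does (l ≟ j) then c * cofactor M i l else 0#))
      ≈⟨ ∑-distrib-+ (λ l → M i l * cofactor M i l) (λ l → if does (l ≟ j) then c * cofactor M i l else 0#) ⟩
    sum (λ l → M i l * cofactor M i l) + sum (λ l → if does (l ≟ j) then c * cofactor M i l else 0#)
      ≈⟨ +-cong (sym (laplace M i)) (sum-indicator j (λ l → c * cofactor M i l)) ⟩
    det M + c * cofactor M i j ∎
    where
    δ : Fin _ → Carrier
    δ l = if does (l ≟ j) then c else 0#
    rowᵢ : ∀ l → addEntry M i j c i l ≈ M i l + δ l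
    rowᵢ l = reflexive (≡.cong (λ t → M i l + (if t ∧ does (l ≟ j) then c else 0#)) (dec-true (i ≟ i) ≡.refl))
    row≢ᵢ : ∀ a l → addEntry M i j c (punchIn i a) l ≈ M (punchIn i a) l
    row≢ᵢ a l = trans
      (reflexive (≡.cong (λ t → M (punchIn i a) l + (if t ∧ does (l ≟ j) then c else 0#))
        (dec-false (punchIn i a ≟ i) (punchInᵢ≢i i a))))
      (+-identityʳ _)
    select : ∀ l → δ l * cofactor M i l ≈ (if does (l ≟ j) then c * cofactor M i l else 0#)
    select l with does (l ≟ j)
    ... | true  = refl
    ... | false = zeroˡ _

  det-addDiagonalEntry : ∀ {n} (M : Matrix Carrier (suc n)) i c →
    det (addEntry M i i c) ≈ det M + c * det (minor M i i)
  det-addDiagonalEntry M i c = trans (det-addEntry M i i c)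
    (+-congˡ (*-congˡ (trans (*-congʳ (sign-double (toℕ i))) (*-identityˡ _))))

  minor-addEntry : ∀ {n} (M : Matrix Carrier (suc n)) {v u} (v≢u : v ≢ u) c i j →
    minor (addEntry M u u c) v v i j ≡ addEntry (minor M v v) (punchOut v≢u) (punchOut v≢u) c i j
  minor-addEntry M v≢u c i j =
    ≡.cong₂ (λ s t → minor M _ _ i j + (if s ∧ t then c else 0#)) (does-punchOut v≢u i) (does-punchOut v≢u j)

  -- The corner `x` and the edge entry `e` are parameters because two instances occur: corner 0 and
  -- edge 1 over the field give the adjacency matrix with a pendant vertex, and corner `X` and edge
  -- minus one over polynomials give its characteristic matrix.
  border : ∀ {n} → Carrier → Carrier → Fin n → Matrix Carrier n → Matrix Carrier (suc n)
  border x e u M zero    zero    = x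
  border x e u M zero    (suc j) = if does (j ≟ u) then e else 0#
  border x e u M (suc i) zero    = if does (i ≟ u) then e else 0#
  border x e u M (suc i) (suc j) = M i j

  minor-border : ∀ {n} x e (M : Matrix Carrier (suc n)) {v u} (v≢u : v ≢ u) i j →
    minor (border x e u M) (suc v) (suc v) i j ≡ border x e (punchOut v≢u) (minor M v v) i j
  minor-border x e M v≢u zero    zero    = ≡.refl
  minor-border x e M v≢u zero    (suc j) = ≡.cong (if_then e else 0#) (does-punchOut v≢u j)
  minor-border x e M v≢u (suc i) zero    = ≡.cong (if_then e else 0#) (does-punchOut v≢u i)
  minor-border x e M v≢u (suc i) (suc j) = ≡.refl

  -- The new row contributes at most two terms, at the corner and at the column of `u`; the minor of
  -- the second again has at most one nonzero entry in the new column. The sign of `u` occurs twice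
  -- and cancels, and the shift from `u` to `suc u` leaves the minus sign.
  det-border : ∀ {n} x e u (M : Matrix Carrier (suc n)) →
    det (border x e u M) ≈ x * det M - e * e * det (minor M u u)
  det-border {n} x e u M = begin
    det N
      ≈⟨ laplace N zero ⟩
    x * cofactor N zero zero + sum (λ j → N zero (suc j) * cofactor N zero (suc j))
      ≈⟨ +-cong (*-congˡ (*-identityˡ _)) (trans (sum-cong select) (sum-indicator u (λ j → e * cofactor N zero (suc j)))) ⟩
    x * det M + e * (sign (suc (toℕ u)) * det W)
      ≈⟨ +-congˡ (*-congˡ (*-cong (sign-suc (toℕ u)) detW)) ⟩
    x * det M + e * (- s * (e * (s * d)))
      ≈⟨ +-congˡ signs ⟩
    x * det M - e * e * d ∎
    where
    N = border x e u M
    W = minor N zero (suc u)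
    s = sign (toℕ u)
    d = det (minor M u u)

    select : ∀ j → N zero (suc j) * cofactor N zero (suc j) ≈ (if does (j ≟ u) then e * cofactor N zero (suc j) else 0#)
    select j with does (j ≟ u)
    ... | true  = refl
    ... | false = zeroˡ _

    -- `W` is a matrix with zero first column plus the single entry `e` in row `u`, so
    -- `det-addEntry` reduces its determinant to one cofactor.
    W₀ : Matrix Carrier (suc n)
    W₀ i zero    = 0#
    W₀ i (suc j) = M i (punchIn u j)

    W≈ : ∀ i j → W i j ≈ addEntry W₀ u zero e i j
    W≈ i zero with does (i ≟ u)
    ... | true  = sym (+-identityˡ e)
    ... | false = sym (+-identityˡ 0#)
    W≈ i (suc j) with does (i ≟ u)
    ... | true  = sym (+-identityʳ _)
    ... | false = sym (+-identityʳ _)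

    detW : det W ≈ e * (s * d)
    detW = begin
      det W                               ≈⟨ det-cong W≈ ⟩
      det (addEntry W₀ u zero e)          ≈⟨ det-addEntry W₀ u zero e ⟩
      det W₀ + e * cofactor W₀ u zero     ≈⟨ +-cong (det-zeroColumn W₀ (λ _ → refl)) (*-congˡ (*-congʳ (reflexive (≡.cong sign (ℕ.+-identityʳ (toℕ u)))))) ⟩
      0# + e * (s * d)                    ≈⟨ +-identityˡ _ ⟩
      e * (s * d)                         ∎

    signs : e * (- s * (e * (s * d))) ≈ - (e * e * d)
    signs = begin
      e * (- s * (e * (s * d)))     ≈⟨ *-congˡ (x∙yz≈y∙xz (- s) e (s * d)) ⟩
      e * (e * (- s * (s * d)))     ≈⟨ *-congˡ (*-congˡ (-‿distribˡ-* s (s * d))) ⟨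
      e * (e * - (s * (s * d)))     ≈⟨ *-assoc _ _ _ ⟨
      e * e * - (s * (s * d))       ≈⟨ -‿distribʳ-* _ _ ⟨
      - (e * e * (s * (s * d)))     ≈⟨ -‿cong (*-congˡ (*-assoc _ _ _)) ⟨
      - (e * e * (s * s * d))       ≈⟨ -‿cong (*-congˡ (*-congʳ (^-homo-* (- 1#) (toℕ u) (toℕ u)))) ⟨
      - (e * e * (sign (toℕ u ℕ.+ toℕ u) * d)) ≈⟨ -‿cong (*-congˡ (*-congʳ (sign-double (toℕ u)))) ⟩
      - (e * e * (1# * d))          ≈⟨ -‿cong (*-congˡ (*-identityˡ d)) ⟩
      - (e * e * d)                 ∎

-- The commutative ring of coefficient lists

module PolynomialProperties {c ℓ} (R : CommutativeRing c ℓ) where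
  open CommutativeRing R hiding (zero)
  open Polynomial rawRing
  open RingProperties ring using (-0#≈0#; -‿distribˡ-*)
  open CommutativeSemigroupProperties +-commutativeSemigroup using (interchange; x∙yz≈y∙xz)

  ≈ₚ-isEquivalence : IsEquivalence _≈ₚ_
  ≈ₚ-isEquivalence = record
    { refl  = λ k → refl
    ; sym   = λ p≈q k → sym (p≈q k)
    ; trans = λ p≈q q≈r k → trans (p≈q k) (q≈r k)
    }

  module ≈-Reasoning = SetoidReasoning setoid

  coeff-+ : ∀ p q k → coeff (p +ₚ q) k ≈ coeff p k + coeff q k
  coeff-+ []      q       k       = sym (+-identityˡ _)
  coeff-+ (a ∷ p) []      k       = sym (+-identityʳ _)
  coeff-+ (a ∷ p) (b ∷ q) zero    = refl
  coeff-+ (a ∷ p) (b ∷ q) (suc k) = coeff-+ p q k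

  coeff-map : ∀ {f} → f 0# ≈ 0# → ∀ p k → coeff (map f p) k ≈ f (coeff p k)
  coeff-map f0≈0 []      k       = sym f0≈0
  coeff-map f0≈0 (a ∷ p) zero    = refl
  coeff-map f0≈0 (a ∷ p) (suc k) = coeff-map f0≈0 p k

  coeff-neg : ∀ p k → coeff (map -_ p) k ≈ - coeff p k
  coeff-neg = coeff-map -0#≈0#

  coeff-scale : ∀ a p k → coeff (map (a *_) p) k ≈ a * coeff p k
  coeff-scale a = coeff-map (zeroʳ a)

  coeff-*-zero : ∀ a p q → coeff ((a ∷ p) *ₚ q) 0 ≈ a * coeff q 0
  coeff-*-zero a p q = trans (coeff-+ (map (a *_) q) (0# ∷ (p *ₚ q)) 0)
    (trans (+-identityʳ _) (coeff-scale a q 0))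

  coeff-*-suc : ∀ a p q k → coeff ((a ∷ p) *ₚ q) (suc k) ≈ a * coeff q (suc k) + coeff (p *ₚ q) k
  coeff-*-suc a p q k = trans (coeff-+ (map (a *_) q) (0# ∷ (p *ₚ q)) (suc k))
    (+-congʳ (coeff-scale a q (suc k)))

  *ₚ-congˡ : ∀ p {q r} → q ≈ₚ r → p *ₚ q ≈ₚ p *ₚ r
  *ₚ-congˡ []      q≈r k = refl
  *ₚ-congˡ (a ∷ p) {q} {r} q≈r zero =
    trans (coeff-*-zero a p q) (trans (*-congˡ (q≈r 0)) (sym (coeff-*-zero a p r)))
  *ₚ-congˡ (a ∷ p) {q} {r} q≈r (suc k) = trans (coeff-*-suc a p q k)
    (trans (+-cong (*-congˡ (q≈r (suc k))) (*ₚ-congˡ p q≈r k)) (sym (coeff-*-suc a p r k)))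

  *ₚ-zeroʳ : ∀ p → p *ₚ [] ≈ₚ []
  *ₚ-zeroʳ []      k       = refl
  *ₚ-zeroʳ (a ∷ p) zero    = refl
  *ₚ-zeroʳ (a ∷ p) (suc k) = *ₚ-zeroʳ p k

  coeff-*-∷-zero : ∀ p b q → coeff (p *ₚ (b ∷ q)) 0 ≈ coeff p 0 * b
  coeff-*-∷-zero []      b q = sym (zeroˡ b)
  coeff-*-∷-zero (a ∷ p) b q = coeff-*-zero a p (b ∷ q)

  -- Multiplication recurses on its left factor. This is the mirror recursion on the right factor;
  -- comparing the two gives commutativity.
  coeff-*-∷-suc : ∀ p b q k → coeff (p *ₚ (b ∷ q)) (suc k) ≈ coeff p (suc k) * b + coeff (p *ₚ q) k
  coeff-*-∷-suc []      b q k       = sym (trans (+-identityʳ _) (zeroˡ b))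
  coeff-*-∷-suc (a ∷ p) b q zero    = begin
    coeff ((a ∷ p) *ₚ (b ∷ q)) 1                       ≈⟨ coeff-*-suc a p (b ∷ q) 0 ⟩
    a * coeff q 0 + coeff (p *ₚ (b ∷ q)) 0             ≈⟨ +-cong (sym (coeff-*-zero a p q)) (coeff-*-∷-zero p b q) ⟩
    coeff ((a ∷ p) *ₚ q) 0 + coeff p 0 * b             ≈⟨ +-comm _ _ ⟩
    coeff p 0 * b + coeff ((a ∷ p) *ₚ q) 0             ∎
    where open ≈-Reasoning
  coeff-*-∷-suc (a ∷ p) b q (suc k) = begin
    coeff ((a ∷ p) *ₚ (b ∷ q)) (suc (suc k))                                   ≈⟨ coeff-*-suc a p (b ∷ q) (suc k) ⟩
    a * coeff q (suc k) + coeff (p *ₚ (b ∷ q)) (suc k)                         ≈⟨ +-congˡ (coeff-*-∷-suc p b q k) ⟩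
    a * coeff q (suc k) + (coeff p (suc k) * b + coeff (p *ₚ q) k)             ≈⟨ x∙yz≈y∙xz _ _ _ ⟩
    coeff p (suc k) * b + (a * coeff q (suc k) + coeff (p *ₚ q) k)             ≈⟨ +-congˡ (coeff-*-suc a p q k) ⟨
    coeff p (suc k) * b + coeff ((a ∷ p) *ₚ q) (suc k)                         ∎
    where open ≈-Reasoning

  *ₚ-comm : ∀ p q → p *ₚ q ≈ₚ q *ₚ p
  *ₚ-comm []      q k       = sym (*ₚ-zeroʳ q k)
  *ₚ-comm (a ∷ p) q zero    = trans (coeff-*-zero a p q) (trans (*-comm _ _) (sym (coeff-*-∷-zero q a p)))
  *ₚ-comm (a ∷ p) q (suc k) = trans (coeff-*-suc a p q k)
    (trans (+-cong (*-comm _ _) (*ₚ-comm p q k)) (sym (coeff-*-∷-suc q a p k)))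

  -- Equal polynomials may be lists of different lengths, so recursion on two left factors in
  -- parallel does not fit. Commutativity moves each change into the right factor.
  *ₚ-cong : ∀ {p p′ q q′} → p ≈ₚ p′ → q ≈ₚ q′ → p *ₚ q ≈ₚ p′ *ₚ q′
  *ₚ-cong {p} {p′} {q} {q′} p≈p′ q≈q′ k = begin
    coeff (p *ₚ q) k    ≈⟨ *ₚ-congˡ p q≈q′ k ⟩
    coeff (p *ₚ q′) k   ≈⟨ *ₚ-comm p q′ k ⟩
    coeff (q′ *ₚ p) k   ≈⟨ *ₚ-congˡ q′ p≈p′ k ⟩
    coeff (q′ *ₚ p′) k  ≈⟨ *ₚ-comm q′ p′ k ⟩
    coeff (p′ *ₚ q′) k  ∎
    where open ≈-Reasoning

  *ₚ-distribˡ : ∀ p q r → p *ₚ (q +ₚ r) ≈ₚ (p *ₚ q) +ₚ (p *ₚ r)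
  *ₚ-distribˡ []      q r k = refl
  *ₚ-distribˡ (a ∷ p) q r zero = begin
    coeff ((a ∷ p) *ₚ (q +ₚ r)) 0                      ≈⟨ coeff-*-zero a p (q +ₚ r) ⟩
    a * coeff (q +ₚ r) 0                               ≈⟨ *-congˡ (coeff-+ q r 0) ⟩
    a * (coeff q 0 + coeff r 0)                        ≈⟨ distribˡ _ _ _ ⟩
    a * coeff q 0 + a * coeff r 0                      ≈⟨ +-cong (coeff-*-zero a p q) (coeff-*-zero a p r) ⟨
    coeff ((a ∷ p) *ₚ q) 0 + coeff ((a ∷ p) *ₚ r) 0    ≈⟨ coeff-+ ((a ∷ p) *ₚ q) _ 0 ⟨
    coeff (((a ∷ p) *ₚ q) +ₚ ((a ∷ p) *ₚ r)) 0         ∎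
    where open ≈-Reasoning
  *ₚ-distribˡ (a ∷ p) q r (suc k) = begin
    coeff ((a ∷ p) *ₚ (q +ₚ r)) (suc k)
      ≈⟨ coeff-*-suc a p (q +ₚ r) k ⟩
    a * coeff (q +ₚ r) (suc k) + coeff (p *ₚ (q +ₚ r)) k
      ≈⟨ +-cong (trans (*-congˡ (coeff-+ q r (suc k))) (distribˡ _ _ _))
                (trans (*ₚ-distribˡ p q r k) (coeff-+ (p *ₚ q) (p *ₚ r) k)) ⟩
    (a * coeff q (suc k) + a * coeff r (suc k)) + (coeff (p *ₚ q) k + coeff (p *ₚ r) k)
      ≈⟨ interchange _ _ _ _ ⟩
    (a * coeff q (suc k) + coeff (p *ₚ q) k) + (a * coeff r (suc k) + coeff (p *ₚ r) k)
      ≈⟨ +-cong (coeff-*-suc a p q k) (coeff-*-suc a p r k) ⟨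
    coeff ((a ∷ p) *ₚ q) (suc k) + coeff ((a ∷ p) *ₚ r) (suc k)
      ≈⟨ coeff-+ ((a ∷ p) *ₚ q) _ (suc k) ⟨
    coeff (((a ∷ p) *ₚ q) +ₚ ((a ∷ p) *ₚ r)) (suc k) ∎
    where open ≈-Reasoning

  +ₚ-cong : ∀ {p p′ q q′} → p ≈ₚ p′ → q ≈ₚ q′ → p +ₚ q ≈ₚ p′ +ₚ q′
  +ₚ-cong {p} {p′} {q} {q′} p≈p′ q≈q′ k =
    trans (coeff-+ p q k) (trans (+-cong (p≈p′ k) (q≈q′ k)) (sym (coeff-+ p′ q′ k)))

  *ₚ-distribʳ : ∀ r p q → (p +ₚ q) *ₚ r ≈ₚ (p *ₚ r) +ₚ (q *ₚ r)
  *ₚ-distribʳ r p q k = begin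
    coeff ((p +ₚ q) *ₚ r) k            ≈⟨ *ₚ-comm (p +ₚ q) r k ⟩
    coeff (r *ₚ (p +ₚ q)) k            ≈⟨ *ₚ-distribˡ r p q k ⟩
    coeff ((r *ₚ p) +ₚ (r *ₚ q)) k     ≈⟨ +ₚ-cong {r *ₚ p} {p *ₚ r} {r *ₚ q} (*ₚ-comm r p) (*ₚ-comm r q) k ⟩
    coeff ((p *ₚ r) +ₚ (q *ₚ r)) k     ∎
    where open ≈-Reasoning

  *ₚ-scale : ∀ a p q → map (a *_) p *ₚ q ≈ₚ map (a *_) (p *ₚ q)
  *ₚ-scale a []      q k    = refl
  *ₚ-scale a (b ∷ p) q zero = begin
    coeff ((a * b ∷ map (a *_) p) *ₚ q) 0  ≈⟨ coeff-*-zero (a * b) (map (a *_) p) q ⟩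
    (a * b) * coeff q 0                    ≈⟨ *-assoc _ _ _ ⟩
    a * (b * coeff q 0)                    ≈⟨ *-congˡ (coeff-*-zero b p q) ⟨
    a * coeff ((b ∷ p) *ₚ q) 0             ≈⟨ coeff-scale a ((b ∷ p) *ₚ q) 0 ⟨
    coeff (map (a *_) ((b ∷ p) *ₚ q)) 0    ∎
    where open ≈-Reasoning
  *ₚ-scale a (b ∷ p) q (suc k) = begin
    coeff ((a * b ∷ map (a *_) p) *ₚ q) (suc k)                  ≈⟨ coeff-*-suc (a * b) (map (a *_) p) q k ⟩
    (a * b) * coeff q (suc k) + coeff (map (a *_) p *ₚ q) k      ≈⟨ +-cong (*-assoc _ _ _) (trans (*ₚ-scale a p q k) (coeff-scale a (p *ₚ q) k)) ⟩
    a * (b * coeff q (suc k)) + a * coeff (p *ₚ q) k             ≈⟨ distribˡ _ _ _ ⟨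
    a * (b * coeff q (suc k) + coeff (p *ₚ q) k)                 ≈⟨ *-congˡ (coeff-*-suc b p q k) ⟨
    a * coeff ((b ∷ p) *ₚ q) (suc k)                             ≈⟨ coeff-scale a ((b ∷ p) *ₚ q) (suc k) ⟨
    coeff (map (a *_) ((b ∷ p) *ₚ q)) (suc k)                    ∎
    where open ≈-Reasoning

  *ₚ-shift : ∀ p q → (0# ∷ p) *ₚ q ≈ₚ 0# ∷ (p *ₚ q)
  *ₚ-shift p q zero    = trans (coeff-*-zero 0# p q) (zeroˡ _)
  *ₚ-shift p q (suc k) = trans (coeff-*-suc 0# p q k) (trans (+-congʳ (zeroˡ _)) (+-identityˡ _))

  *ₚ-assoc : ∀ p q r → (p *ₚ q) *ₚ r ≈ₚ p *ₚ (q *ₚ r)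
  *ₚ-assoc []      q r k = refl
  *ₚ-assoc (a ∷ p) q r k = begin
    coeff ((map (a *_) q +ₚ (0# ∷ (p *ₚ q))) *ₚ r) k
      ≈⟨ *ₚ-distribʳ r (map (a *_) q) (0# ∷ (p *ₚ q)) k ⟩
    coeff ((map (a *_) q *ₚ r) +ₚ ((0# ∷ (p *ₚ q)) *ₚ r)) k
      ≈⟨ +ₚ-cong {map (a *_) q *ₚ r} {map (a *_) (q *ₚ r)} {(0# ∷ (p *ₚ q)) *ₚ r} {0# ∷ (p *ₚ (q *ₚ r))} (*ₚ-scale a q r) (λ j → trans (*ₚ-shift (p *ₚ q) r j) (shifted j)) k ⟩
    coeff (map (a *_) (q *ₚ r) +ₚ (0# ∷ (p *ₚ (q *ₚ r)))) k ∎
    where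
    open ≈-Reasoning
    shifted : 0# ∷ ((p *ₚ q) *ₚ r) ≈ₚ 0# ∷ (p *ₚ (q *ₚ r))
    shifted zero    = refl
    shifted (suc j) = *ₚ-assoc p q r j

  *ₚ-identityˡ : ∀ p → [ 1# ] *ₚ p ≈ₚ p
  *ₚ-identityˡ p zero    = trans (coeff-*-zero 1# [] p) (*-identityˡ _)
  *ₚ-identityˡ p (suc k) = trans (coeff-*-suc 1# [] p k) (trans (+-identityʳ _) (*-identityˡ _))

  polyRing : CommutativeRing c ℓ
  polyRing = record
    { RawRing polyRawRing
    ; isCommutativeRing = record
      { isRing = record
        { +-isAbelianGroup = record
          { isGroup = record
            { isMonoid = record
              { isSemigroup = record
                { isMagma = record
                  { isEquivalence = ≈ₚ-isEquivalence
                  ; ∙-cong = λ {p} {p′} {q} {q′} → +ₚ-cong {p} {p′} {q} {q′}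
                  }
                ; assoc = +ₚ-assoc
                }
              ; identity = (λ p k → refl) , +ₚ-identityʳ
              }
            ; inverse = -ₚ-inverseˡ , λ p k → trans (+ₚ-comm p (map -_ p) k) (-ₚ-inverseˡ p k)
            ; ⁻¹-cong = λ {p} {q} p≈q k → trans (coeff-neg p k) (trans (-‿cong (p≈q k)) (sym (coeff-neg q k)))
            }
          ; comm = +ₚ-comm
          }
        ; *-cong = λ {p} {p′} {q} {q′} → *ₚ-cong {p} {p′} {q} {q′}
        ; *-assoc = *ₚ-assoc
        ; *-identity = *ₚ-identityˡ , λ p k → trans (*ₚ-comm p [ 1# ] k) (*ₚ-identityˡ p k)
        ; distrib = *ₚ-distribˡ , *ₚ-distribʳ
        }
      ; *-comm = *ₚ-comm
      }
    }
    where
    +ₚ-comm : ∀ p q → p +ₚ q ≈ₚ q +ₚ p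
    +ₚ-comm p q k = trans (coeff-+ p q k) (trans (+-comm _ _) (sym (coeff-+ q p k)))

    +ₚ-assoc : ∀ p q r → (p +ₚ q) +ₚ r ≈ₚ p +ₚ (q +ₚ r)
    +ₚ-assoc p q r k = begin
      coeff ((p +ₚ q) +ₚ r) k               ≈⟨ coeff-+ (p +ₚ q) r k ⟩
      coeff (p +ₚ q) k + coeff r k          ≈⟨ +-congʳ (coeff-+ p q k) ⟩
      (coeff p k + coeff q k) + coeff r k   ≈⟨ +-assoc _ _ _ ⟩
      coeff p k + (coeff q k + coeff r k)   ≈⟨ +-congˡ (coeff-+ q r k) ⟨
      coeff p k + coeff (q +ₚ r) k          ≈⟨ coeff-+ p (q +ₚ r) k ⟨
      coeff (p +ₚ (q +ₚ r)) k               ∎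
      where open ≈-Reasoning

    +ₚ-identityʳ : ∀ p → p +ₚ [] ≈ₚ p
    +ₚ-identityʳ p k = trans (coeff-+ p [] k) (+-identityʳ _)

    -ₚ-inverseˡ : ∀ p → map -_ p +ₚ p ≈ₚ []
    -ₚ-inverseˡ p k = trans (coeff-+ (map -_ p) p k) (trans (+-congʳ (coeff-neg p k)) (-‿inverseˡ _))

  -- Degree bounds, monic polynomials and linear factors

  coeff-const-* : ∀ a p k → coeff ([ a ] *ₚ p) k ≈ a * coeff p k
  coeff-const-* a p zero    = coeff-*-zero a [] p
  coeff-const-* a p (suc k) = trans (coeff-*-suc a [] p k) (+-identityʳ _)

  coeff-linear-* : ∀ a b p k → coeff ((a ∷ b ∷ []) *ₚ p) (suc k) ≈ a * coeff p (suc k) + b * coeff p k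
  coeff-linear-* a b p k = trans (coeff-*-suc a [ b ] p k) (+-congˡ (coeff-const-* b p k))

  -- A strict upper bound instead of a degree: finding the leading coefficient would mean deciding
  -- which coefficients vanish.
  DegreeBelow : ℕ → Poly → Set ℓ
  DegreeBelow d p = ∀ k → d ≤ k → coeff p k ≈ 0#

  degreeBelow-+ : ∀ {d p q} → DegreeBelow d p → DegreeBelow d q → DegreeBelow d (p +ₚ q)
  degreeBelow-+ {p = p} {q} dp dq k d≤k =
    trans (coeff-+ p q k) (trans (+-cong (dp k d≤k) (dq k d≤k)) (+-identityʳ 0#))

  -- The bounds are strict: degrees at most e and at most d - 1 give a product of degree at most e +
  -- d - 1.
  degreeBelow-* : ∀ {d e} p {q} → DegreeBelow (suc e) p → DegreeBelow d q → DegreeBelow (e ℕ.+ d) (p *ₚ q)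
  degreeBelow-* [] dp dq k _ = refl
  degreeBelow-* {e = zero} (a ∷ p) {q} dp dq k d≤k = begin
    -- The tail `p` may be a nonempty list of zeros, so `a ∷ p` is first replaced by the constant
    -- `a`.
    coeff ((a ∷ p) *ₚ q) k   ≈⟨ *ₚ-cong {a ∷ p} {[ a ]} {q} {q} constant (λ _ → refl) k ⟩
    coeff ([ a ] *ₚ q) k     ≈⟨ coeff-const-* a q k ⟩
    a * coeff q k            ≈⟨ *-congˡ (dq k d≤k) ⟩
    a * 0#                   ≈⟨ zeroʳ a ⟩
    0#                       ∎
    where
    open ≈-Reasoning
    constant : a ∷ p ≈ₚ [ a ]
    constant zero    = refl
    constant (suc k) = dp (suc k) (s≤s z≤n)
  degreeBelow-* {e = suc e} (a ∷ p) {q} dp dq (suc k) (s≤s e+d≤k) = begin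
    coeff ((a ∷ p) *ₚ q) (suc k)              ≈⟨ coeff-*-suc a p q k ⟩
    a * coeff q (suc k) + coeff (p *ₚ q) k    ≈⟨ +-cong (*-congˡ (dq (suc k) (ℕ.m≤n⇒m≤1+n (ℕ.m+n≤o⇒n≤o e e+d≤k))))
                                                        (degreeBelow-* p (λ j e<j → dp (suc j) (s≤s e<j)) dq k e+d≤k) ⟩
    a * 0# + 0#                               ≈⟨ +-identityʳ _ ⟩
    a * 0#                                    ≈⟨ zeroʳ a ⟩
    0#                                        ∎
    where open ≈-Reasoning

  Monic : ℕ → Poly → Set ℓ
  Monic d p = coeff p d ≈ 1# × DegreeBelow (suc d) p

  monic-+ : ∀ {d p q} → Monic d p → DegreeBelow d q → Monic d (p +ₚ q)
  monic-+ {d} {p} {q} (lead , dp) dq =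
    trans (coeff-+ p q d) (trans (+-cong lead (dq d ℕ.≤-refl)) (+-identityʳ 1#)) ,
    degreeBelow-+ {p = p} dp (λ k d<k → dq k (ℕ.<⇒≤ d<k))

  monic-linear-* : ∀ {d} a {p} → Monic d p → Monic (suc d) ((a ∷ 1# ∷ []) *ₚ p)
  monic-linear-* {d} a {p} (lead , dp) =
    (begin
      coeff ((a ∷ 1# ∷ []) *ₚ p) (suc d)      ≈⟨ coeff-linear-* a 1# p d ⟩
      a * coeff p (suc d) + 1# * coeff p d    ≈⟨ +-cong (*-congˡ (dp (suc d) ℕ.≤-refl)) (*-identityˡ _) ⟩
      a * 0# + coeff p d                      ≈⟨ +-cong (zeroʳ a) lead ⟩
      0# + 1#                                 ≈⟨ +-identityˡ 1# ⟩
      1#                                      ∎) ,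
    degreeBelow-* {e = 1} (a ∷ 1# ∷ []) {p} (λ { (suc (suc k)) _ → refl ; (suc zero) (s≤s ()) }) dp
    where open ≈-Reasoning

  monic-cong : ∀ {d p q} → p ≈ₚ q → Monic d p → Monic d q
  monic-cong {d} p≈q (lead , dp) = trans (sym (p≈q d)) lead , λ k d<k → trans (sym (p≈q k)) (dp k d<k)

  -- `algClosed` accepts only lists that literally end in 1, whereas a monic polynomial may have a
  -- leading coefficient merely equal to 1, or trailing zeros. Hence the list is rebuilt from its
  -- coefficient function.
  toMonic : (ℕ → Carrier) → ℕ → Poly
  toMonic f d = applyUpTo f d ++ [ 1# ]

  toMonic-coeff : ∀ f d → f d ≈ 1# → (∀ k → suc d ≤ k → f k ≈ 0#) → ∀ k → coeff (toMonic f d) k ≈ f k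
  toMonic-coeff f zero    lead rest zero    = sym lead
  toMonic-coeff f zero    lead rest (suc k) = sym (rest (suc k) (s≤s z≤n))
  toMonic-coeff f (suc d) lead rest zero    = refl
  toMonic-coeff f (suc d) lead rest (suc k) =
    toMonic-coeff (f ∘ suc) d lead (λ j d<j → rest (suc j) (s≤s d<j)) k

  -- Synthetic division: p = (X − x) * quotient x p + eval p x.
  quotient : Carrier → Poly → Poly
  quotient x []      = []
  quotient x (a ∷ p) = eval p x ∷ quotient x p

  eval-zero : ∀ p x → DegreeBelow 0 p → eval p x ≈ 0#
  eval-zero []      x p≈0 = refl
  eval-zero (a ∷ p) x p≈0 = trans
    (+-cong (p≈0 0 z≤n) (trans (*-congˡ (eval-zero p x (λ k _ → p≈0 (suc k) z≤n))) (zeroʳ x)))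
    (+-identityʳ 0#)

  -- The coefficients of the quotient are the values at `x` of the successive tails of `p`, so this
  -- is one step of Horner's scheme.
  coeff-quotient : ∀ x p k → coeff (quotient x p) k ≈ coeff p (suc k) + x * coeff (quotient x p) (suc k)
  coeff-quotient x []          k       = sym (trans (+-identityˡ _) (zeroʳ x))
  coeff-quotient x (a ∷ [])    zero    = sym (trans (+-identityˡ _) (zeroʳ x))
  coeff-quotient x (a ∷ b ∷ p) zero    = refl
  coeff-quotient x (a ∷ p)     (suc k) = coeff-quotient x p k

  quotient-degreeBelow : ∀ {d} x p → DegreeBelow (suc d) p → DegreeBelow d (quotient x p)
  quotient-degreeBelow         x []      dp k       _         = refl
  quotient-degreeBelow {zero}  x (a ∷ p) dp zero    _         = eval-zero p x (λ k _ → dp (suc k) (s≤s z≤n))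
  quotient-degreeBelow {zero}  x (a ∷ p) dp (suc k) _         =
    quotient-degreeBelow {zero} x p (λ j _ → dp (suc j) (s≤s z≤n)) k z≤n
  quotient-degreeBelow {suc d} x (a ∷ p) dp (suc k) (s≤s d≤k) =
    quotient-degreeBelow x p (λ j d<j → dp (suc j) (s≤s d<j)) k d≤k

  quotient-monic : ∀ {d} x p → Monic (suc d) p → Monic d (quotient x p)
  quotient-monic {d} x p (lead , dp) =
    (begin
      coeff (quotient x p) d                               ≈⟨ coeff-quotient x p d ⟩
      coeff p (suc d) + x * coeff (quotient x p) (suc d)   ≈⟨ +-cong lead (*-congˡ (dq (suc d) ℕ.≤-refl)) ⟩
      1# + x * 0#                                          ≈⟨ +-congˡ (zeroʳ x) ⟩
      1# + 0#                                              ≈⟨ +-identityʳ 1# ⟩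
      1#                                                   ∎) ,
    dq
    where
    open ≈-Reasoning
    dq = quotient-degreeBelow x p dp

  factor : ∀ x p → eval p x ≈ 0# → p ≈ₚ (- x ∷ 1# ∷ []) *ₚ quotient x p
  factor x [] root k = sym (*ₚ-zeroʳ (- x ∷ 1# ∷ []) k)
  factor x (a ∷ p) root zero = begin
    a                                               ≈⟨ +-identityʳ a ⟨
    a + 0#                                          ≈⟨ +-congˡ (-‿inverseʳ _) ⟨
    a + (x * eval p x + - (x * eval p x))           ≈⟨ +-assoc _ _ _ ⟨
    (a + x * eval p x) + - (x * eval p x)           ≈⟨ +-cong root (-‿distribˡ-* x _) ⟩
    0# + - x * eval p x                             ≈⟨ +-identityˡ _ ⟩
    - x * eval p x                                  ≈⟨ coeff-*-zero (- x) [ 1# ] (quotient x (a ∷ p)) ⟨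
    coeff ((- x ∷ 1# ∷ []) *ₚ quotient x (a ∷ p)) 0 ∎
    where open ≈-Reasoning
  factor x (a ∷ p) root (suc k) = begin
    coeff p k                                         ≈⟨ +-identityʳ _ ⟨
    coeff p k + 0#                                    ≈⟨ +-congˡ (-‿inverseʳ _) ⟨
    coeff p k + (x * q′ + - (x * q′))                 ≈⟨ +-assoc _ _ _ ⟨
    (coeff p k + x * q′) + - (x * q′)                 ≈⟨ +-cong (coeff-quotient x (a ∷ p) k) (sym (-‿distribˡ-* x _)) ⟨
    coeff q k + - x * q′                              ≈⟨ +-comm _ _ ⟩
    - x * q′ + coeff q k                              ≈⟨ +-congˡ (*-identityˡ _) ⟨
    - x * q′ + 1# * coeff q k                         ≈⟨ coeff-linear-* (- x) 1# q k ⟨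
    coeff ((- x ∷ 1# ∷ []) *ₚ q) (suc k)              ∎
    where
    open ≈-Reasoning
    q = quotient x (a ∷ p)
    q′ = coeff q (suc k)

-- Characteristic polynomials

module CharacteristicPolynomial {c ℓ} (R : CommutativeRing c ℓ) where
  open CommutativeRing R hiding (zero)
  open Polynomial rawRing
  open PolynomialProperties R
  open RingProperties ring
  open Sum semiring
  open DeterminantProperties R using (sum-cong; sum-zero; sum-indicator; addEntry; border; minor-addEntry; minor-border; x-[y-z]≈x-y+z; sum-neg)
  open MatrixPower (RawRing.rawSemiring rawRing) renaming (_^_ to _^ᴹ_)
  open Determinant rawRing using (minor)
  open SetoidReasoning setoid
  module Poly = CommutativeRing polyRing
  module PolySum = Sum Poly.semiring
  module PolyDet where
    open Determinant polyRawRing public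
    open DeterminantProperties polyRing public

  coeff-- : ∀ p q k → coeff (p Poly.- q) k ≈ coeff p k - coeff q k
  coeff-- p q k = trans (coeff-+ p (Poly.- q) k) (+-congˡ (coeff-neg q k))

  charMatrix : ∀ {n} → Matrix Carrier n → Matrix Poly n
  charMatrix M i j = if does (i ≟ j) then - M i j ∷ 1# ∷ [] else [ - M i j ]

  charMatrix-cong : ∀ {n} {M N : Matrix Carrier n} → (∀ i j → M i j ≈ N i j) → ∀ i j → charMatrix M i j ≈ₚ charMatrix N i j
  charMatrix-cong M≈N i j k with does (i ≟ j) | k
  ... | true  | zero        = -‿cong (M≈N i j)
  ... | true  | suc k       = refl
  ... | false | zero        = -‿cong (M≈N i j)
  ... | false | suc k       = refl

  charPoly-cong : ∀ {n} {M N : Matrix Carrier n} → (∀ i j → M i j ≈ N i j) → charPoly M ≈ₚ charPoly N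
  charPoly-cong {M = M} {N} M≈N = PolyDet.det-cong {M = charMatrix M} {charMatrix N} (charMatrix-cong M≈N)

  charMatrix-minor : ∀ {n} (M : Matrix Carrier (suc n)) u i j →
    PolyDet.minor (charMatrix M) u u i j ≡ charMatrix (minor M u u) i j
  charMatrix-minor M u i j = ≡.cong
    (λ t → if t then - M (punchIn u i) (punchIn u j) ∷ 1# ∷ [] else [ - M (punchIn u i) (punchIn u j) ])
    (does-punchIn u i j)

  det-charMatrix-minor : ∀ {n} (M : Matrix Carrier (suc n)) u →
    PolyDet.det (PolyDet.minor (charMatrix M) u u) ≈ₚ charPoly (minor M u u)
  det-charMatrix-minor M u = PolyDet.det-cong {M = PolyDet.minor (charMatrix M) u u} {charMatrix (minor M u u)} λ i j → Poly.reflexive (charMatrix-minor M u i j)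

  degreeBelow-sum : ∀ {n d} (f : Fin n → Poly) → (∀ j → DegreeBelow d (f j)) → DegreeBelow d (PolySum.sum f)
  degreeBelow-sum {zero}  f df k _ = refl
  degreeBelow-sum {suc n} f df     = degreeBelow-+ {p = f zero} (df zero) (degreeBelow-sum (f ∘ suc) (df ∘ suc))

  coeff-sum : ∀ {n} (f : Fin n → Poly) k → coeff (PolySum.sum f) k ≈ sum (λ j → coeff (f j) k)
  coeff-sum {zero}  f k = refl
  coeff-sum {suc n} f k = trans (coeff-+ (f zero) (PolySum.sum (f ∘ suc)) k) (+-congˡ (coeff-sum (f ∘ suc) k))

  degreeBelow-sign : ∀ {d} m p → DegreeBelow d p → DegreeBelow d (PolyDet.sign m *ₚ p)
  degreeBelow-sign zero    p dp k d≤k = trans (*ₚ-identityˡ p k) (dp k d≤k)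
  degreeBelow-sign (suc m) p dp k d≤k = begin
    coeff ((Poly.- Poly.1# *ₚ PolyDet.sign m) *ₚ p) k   ≈⟨ *ₚ-assoc [ - 1# ] (PolyDet.sign m) p k ⟩
    coeff ([ - 1# ] *ₚ (PolyDet.sign m *ₚ p)) k         ≈⟨ coeff-const-* (- 1#) (PolyDet.sign m *ₚ p) k ⟩
    - 1# * coeff (PolyDet.sign m *ₚ p) k                ≈⟨ *-congˡ (degreeBelow-sign m p dp k d≤k) ⟩
    - 1# * 0#                                           ≈⟨ zeroʳ _ ⟩
    0#                                                  ∎

  -- Each of the n factors of a term has degree at most one. The entries are general because the
  -- bound is also applied to off-diagonal minors of a characteristic matrix, which are not
  -- characteristic matrices themselves.
  degreeBelow-det : ∀ {n} (L : Matrix Poly n) → (∀ i j → DegreeBelow 2 (L i j)) → DegreeBelow (suc n) (PolyDet.det L)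
  degreeBelow-det {zero}  L dL (suc k) _ = refl
  degreeBelow-det {suc n} L dL = degreeBelow-sum
    (λ j → PolyDet.sign (toℕ j) *ₚ (L zero j *ₚ PolyDet.det (PolyDet.minor L zero j)))
    λ j → degreeBelow-sign (toℕ j) (L zero j *ₚ PolyDet.det (PolyDet.minor L zero j))
            (degreeBelow-* {e = 1} (L zero j) (dL zero j)
              (degreeBelow-det (PolyDet.minor L zero j) (λ k l → dL (suc k) (punchIn j l))))

  charMatrix-degreeBelow : ∀ {n} (M : Matrix Carrier n) i j → DegreeBelow 2 (charMatrix M i j)
  charMatrix-degreeBelow M i j k 2≤k with does (i ≟ j) | k | 2≤k
  ... | true  | suc (suc k) | _ = refl
  ... | true  | suc zero    | s≤s ()
  ... | false | suc (suc k) | _ = refl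
  ... | false | suc zero    | s≤s ()

  -- Only the diagonal term of the row-zero expansion reaches full degree. In every other term the
  -- entry of row zero is constant, and the minor contributes degree at most its size.
  charPoly-monic : ∀ {n} (M : Matrix Carrier n) → Monic n (charPoly M)
  charPoly-monic {zero}  M = refl , λ { (suc k) _ → refl }
  charPoly-monic {suc n} M = monic-+ {p = Poly.1# *ₚ leading} {PolySum.sum others}
    (monic-cong {p = leading} {Poly.1# *ₚ leading} (λ k → sym (*ₚ-identityˡ leading k))
      (monic-linear-* (- M zero zero) {charPoly (minor M zero zero)} (charPoly-monic (minor M zero zero))))
    (degreeBelow-sum others λ j →
      degreeBelow-sign (suc (toℕ j)) (charMatrix M zero (suc j) *ₚ PolyDet.det (others-minor j))
        (degreeBelow-* {e = 0} (charMatrix M zero (suc j)) {PolyDet.det (others-minor j)} (λ { (suc k) _ → refl })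
          (degreeBelow-det (others-minor j) (λ k l → charMatrix-degreeBelow M (suc k) (punchIn (suc j) l)))))
    where
    leading = charMatrix M zero zero *ₚ charPoly (minor M zero zero)
    others-minor : Fin n → Matrix Poly n
    others-minor j = PolyDet.minor (charMatrix M) zero (suc j)
    others : Fin n → Poly
    others j = PolyDet.sign (suc (toℕ j)) *ₚ (charMatrix M zero (suc j) *ₚ PolyDet.det (others-minor j))

  -- Effect of loops and pendant vertices

  charPoly-addDiagonalEntry : ∀ {n} (M : Matrix Carrier (suc n)) u →
    charPoly (addEntry M u u 1#) ≈ₚ charPoly M Poly.- charPoly (minor M u u)
  charPoly-addDiagonalEntry M u k = begin
    coeff (charPoly (addEntry M u u 1#)) k
      ≈⟨ PolyDet.det-cong {M = charMatrix (addEntry M u u 1#)} {PolyDet.addEntry (charMatrix M) u u [ - 1# ]} entry k ⟩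
    coeff (PolyDet.det (PolyDet.addEntry (charMatrix M) u u [ - 1# ])) k
      ≈⟨ PolyDet.det-addDiagonalEntry (charMatrix M) u [ - 1# ] k ⟩
    coeff (charPoly M +ₚ [ - 1# ] *ₚ d) k
      ≈⟨ coeff-+ (charPoly M) ([ - 1# ] *ₚ d) k ⟩
    coeff (charPoly M) k + coeff ([ - 1# ] *ₚ d) k
      ≈⟨ +-congˡ (trans (coeff-const-* (- 1#) d k) (-1*x≈-x _)) ⟩
    coeff (charPoly M) k - coeff d k
      ≈⟨ +-congˡ (-‿cong (det-charMatrix-minor M u k)) ⟩
    coeff (charPoly M) k - coeff (charPoly (minor M u u)) k
      ≈⟨ coeff-- (charPoly M) (charPoly (minor M u u)) k ⟨
    coeff (charPoly M Poly.- charPoly (minor M u u)) k ∎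
    where
    d = PolyDet.det (PolyDet.minor (charMatrix M) u u)
    entry : ∀ i j → charMatrix (addEntry M u u 1#) i j ≈ₚ PolyDet.addEntry (charMatrix M) u u [ - 1# ] i j
    entry i j k with does (i ≟ j) | does (i ≟ u) ∧ does (j ≟ u) | k
    ... | true  | true  | zero        = sym (-‿+-comm (M i j) 1#)
    ... | true  | true  | suc _       = refl
    ... | true  | false | zero        = -‿cong (+-identityʳ _)
    ... | true  | false | suc _       = refl
    ... | false | true  | zero        = sym (-‿+-comm (M i j) 1#)
    ... | false | true  | suc _       = refl
    ... | false | false | zero        = -‿cong (+-identityʳ _)
    ... | false | false | suc _       = refl

  X : Poly
  X = 0# ∷ 1# ∷ []

  charPoly-border : ∀ {n} u (M : Matrix Carrier (suc n)) →
    charPoly (border 0# 1# u M) ≈ₚ X *ₚ charPoly M Poly.- charPoly (minor M u u)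
  charPoly-border u M k = begin
    coeff (charPoly (border 0# 1# u M)) k
      ≈⟨ PolyDet.det-cong {M = charMatrix (border 0# 1# u M)} {B} entry k ⟩
    coeff (PolyDet.det B) k
      ≈⟨ PolyDet.det-border X [ - 1# ] u (charMatrix M) k ⟩
    coeff (X *ₚ charPoly M Poly.- [ - 1# ] *ₚ [ - 1# ] *ₚ d) k
      ≈⟨ coeff-- (X *ₚ charPoly M) ([ - 1# ] *ₚ [ - 1# ] *ₚ d) k ⟩
    coeff (X *ₚ charPoly M) k - coeff ([ - 1# ] *ₚ [ - 1# ] *ₚ d) k
      ≈⟨ +-congˡ (-‿cong (trans (square k) (det-charMatrix-minor M u k))) ⟩
    coeff (X *ₚ charPoly M) k - coeff (charPoly (minor M u u)) k
      ≈⟨ coeff-- (X *ₚ charPoly M) (charPoly (minor M u u)) k ⟨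
    coeff (X *ₚ charPoly M Poly.- charPoly (minor M u u)) k ∎
    where
    B = PolyDet.border X [ - 1# ] u (charMatrix M)
    d = PolyDet.det (PolyDet.minor (charMatrix M) u u)

    square : [ - 1# ] *ₚ [ - 1# ] *ₚ d ≈ₚ d
    square k = begin
      coeff ([ - 1# ] *ₚ [ - 1# ] *ₚ d) k      ≈⟨ *ₚ-assoc [ - 1# ] [ - 1# ] d k ⟩
      coeff ([ - 1# ] *ₚ ([ - 1# ] *ₚ d)) k    ≈⟨ coeff-const-* (- 1#) ([ - 1# ] *ₚ d) k ⟩
      - 1# * coeff ([ - 1# ] *ₚ d) k           ≈⟨ -1*x≈-x _ ⟩
      - coeff ([ - 1# ] *ₚ d) k                ≈⟨ -‿cong (trans (coeff-const-* (- 1#) d k) (-1*x≈-x _)) ⟩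
      - - coeff d k                            ≈⟨ -‿involutive _ ⟩
      coeff d k                                ∎

    edge : ∀ b → [ - (if b then 1# else 0#) ] ≈ₚ (if b then [ - 1# ] else [])
    edge true  k       = refl
    edge false zero    = -0#≈0#
    edge false (suc k) = refl

    entry : ∀ i j → charMatrix (border 0# 1# u M) i j ≈ₚ B i j
    entry zero    zero    zero    = -0#≈0#
    entry zero    zero    (suc k) = refl
    entry zero    (suc j) k       = edge (does (j ≟ u)) k
    entry (suc i) zero    k       = edge (does (i ≟ u)) k
    entry (suc i) (suc j) k       = refl

  module _ {n} (M : Matrix Carrier (suc (suc n))) {u v : Fin (suc (suc n))} (u≢v : u ≢ v) where

    private
      v≢u : v ≢ u
      v≢u = u≢v ∘ ≡.sym
      φ   = charPoly M
      φᵤ  = charPoly (minor M u u)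
      φᵥ  = charPoly (minor M v v)
      φᵤᵥ = charPoly (minor (minor M u u) (punchOut u≢v) (punchOut u≢v))
      φᵥᵤ = charPoly (minor (minor M v v) (punchOut v≢u) (punchOut v≢u))

      -- The modification at `v` is made last and hence undone first, so the computation meets `v`
      -- deleted before `u`; `delete₂` removes them in the opposite order.
      φᵥᵤ≈φᵤᵥ : φᵥᵤ ≈ₚ φᵤᵥ
      φᵥᵤ≈φᵤᵥ = charPoly-cong {M = minor (minor M v v) (punchOut v≢u) (punchOut v≢u)} λ i j → reflexive
        (≡.cong₂ M (punchIn-punchOut-swap v≢u u≢v i) (punchIn-punchOut-swap v≢u u≢v j))

      -- The common shape of both constructions: `s` comes from the matrix modified only at `u`, and
      -- `Q` from that matrix with `v` removed, where the formula for `u` applies once more.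
      combine : ∀ {P Q s r} p → P ≈ₚ s Poly.- Q → Q ≈ₚ r Poly.- p → p ≈ₚ φᵤᵥ → P ≈ₚ (s Poly.- r) Poly.+ φᵤᵥ
      combine {P} {Q} {s} {r} p P≈ Q≈ p≈ k = begin
        coeff P k                             ≈⟨ P≈ k ⟩
        coeff (s Poly.- Q) k                  ≈⟨ coeff-- s Q k ⟩
        coeff s k - coeff Q k                 ≈⟨ +-congˡ (-‿cong (trans (Q≈ k) (coeff-- r p k))) ⟩
        coeff s k - (coeff r k - coeff p k)   ≈⟨ x-[y-z]≈x-y+z _ _ _ ⟩
        (coeff s k - coeff r k) + coeff p k   ≈⟨ +-cong (sym (coeff-- s r k)) (p≈ k) ⟩
        coeff (s Poly.- r) k + coeff φᵤᵥ k    ≈⟨ coeff-+ (s Poly.- r) φᵤᵥ k ⟨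
        coeff ((s Poly.- r) Poly.+ φᵤᵥ) k     ∎

    charPoly-loops : charPoly (addEntry (addEntry M u u 1#) v v 1#) ≈ₚ ((φ Poly.- φᵤ) Poly.- φᵥ) Poly.+ φᵤᵥ
    charPoly-loops = combine {P} {Q} {φ Poly.- φᵤ} {φᵥ} φᵥᵤ
      (λ k → trans (charPoly-addDiagonalEntry (addEntry M u u 1#) v k)
        (Poly.+-congʳ {Poly.- Q} {charPoly (addEntry M u u 1#)} {φ Poly.- φᵤ} (charPoly-addDiagonalEntry M u) k))
      (λ k → trans (charPoly-cong {M = minor (addEntry M u u 1#) v v} (λ i j → reflexive (minor-addEntry M v≢u 1# i j)) k)
        (charPoly-addDiagonalEntry (minor M v v) (punchOut v≢u) k))
      φᵥᵤ≈φᵤᵥ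
      where
      P = charPoly (addEntry (addEntry M u u 1#) v v 1#)
      Q = charPoly (minor (addEntry M u u 1#) v v)

    charPoly-pendants : charPoly (border 0# 1# (suc v) (border 0# 1# u M)) ≈ₚ
      (X *ₚ (X *ₚ φ Poly.- φᵤ) Poly.- X *ₚ φᵥ) Poly.+ φᵤᵥ
    charPoly-pendants = combine {P} {Q} {X *ₚ (X *ₚ φ Poly.- φᵤ)} {X *ₚ φᵥ} φᵥᵤ
      (λ k → trans (charPoly-border (suc v) (border 0# 1# u M) k)
        (Poly.+-congʳ {Poly.- Q} {X *ₚ charPoly (border 0# 1# u M)} {X *ₚ (X *ₚ φ Poly.- φᵤ)} (*ₚ-congˡ X {charPoly (border 0# 1# u M)} {X *ₚ φ Poly.- φᵤ} (charPoly-border u M)) k))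
      (λ k → trans (charPoly-cong {M = minor (border 0# 1# u M) (suc v) (suc v)} (λ i j → reflexive (minor-border 0# 1# M v≢u i j)) k)
        (charPoly-border (punchOut v≢u) (minor M v v) k))
      φᵥᵤ≈φᵤᵥ
      where
      P = charPoly (border 0# 1# (suc v) (border 0# 1# u M))
      Q = charPoly (minor (border 0# 1# u M) (suc v) (suc v))

  -- Coefficients of the cofactor matrix and closed walks

  ⊗-assoc : ∀ {n} (A B D : Matrix Carrier n) i j → ((A ⊗ B) ⊗ D) i j ≈ (A ⊗ (B ⊗ D)) i j
  ⊗-assoc A B D i j = begin
    sum (λ k → sum (λ l → A i l * B l k) * D k j)      ≈⟨ sum-cong (λ k → *-distribʳ-sum (D k j) (λ l → A i l * B l k)) ⟩
    sum (λ k → sum (λ l → (A i l * B l k) * D k j))    ≈⟨ ∑-comm (λ k l → (A i l * B l k) * D k j) ⟩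
    sum (λ l → sum (λ k → (A i l * B l k) * D k j))    ≈⟨ sum-cong (λ l → sum-cong (λ k → *-assoc (A i l) (B l k) (D k j))) ⟩
    sum (λ l → sum (λ k → A i l * (B l k * D k j)))    ≈⟨ sum-cong (λ l → *-distribˡ-sum (A i l) (λ k → B l k * D k j)) ⟨
    sum (λ l → A i l * sum (λ k → B l k * D k j))      ∎

  if-*ˡ : ∀ b x y → (if b then x else 0#) * y ≈ (if b then x * y else 0#)
  if-*ˡ true  x y = refl
  if-*ˡ false x y = zeroˡ y

  module _ {n} (M : Matrix Carrier (suc n)) (symmetric : ∀ i j → M i j ≈ M j i) where

    C : ℕ → Matrix Carrier (suc n)
    C k i j = coeff (PolyDet.cofactor (charMatrix M) i j) k

    C-vanishes : ∀ k → suc n ≤ k → ∀ i j → C k i j ≈ 0#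
    C-vanishes k n<k i j = degreeBelow-sign (toℕ i ℕ.+ toℕ j) (PolyDet.det (PolyDet.minor (charMatrix M) i j))
      (degreeBelow-det (PolyDet.minor (charMatrix M) i j) (λ a b → charMatrix-degreeBelow M (punchIn i a) (punchIn j b))) k n<k

    -- The test reads `j ≟ i`, opposite to `charMatrix`, so that `sum-indicator` can collapse a
    -- later sum over `j`.
    coeff-charMatrix-* : ∀ i j p k → coeff (charMatrix M i j *ₚ p) (suc k) ≈
      - (M i j * coeff p (suc k)) + (if does (j ≟ i) then coeff p k else 0#)
    coeff-charMatrix-* i j p k with i ≟ j
    ... | yes ≡.refl rewrite dec-true (i ≟ i) ≡.refl =
      trans (coeff-linear-* (- M i j) 1# p k) (+-cong (sym (-‿distribˡ-* _ _)) (*-identityˡ _))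
    ... | no i≢j rewrite dec-false (j ≟ i) (i≢j ∘ ≡.sym) =
      trans (coeff-const-* (- M i j) p (suc k)) (trans (sym (-‿distribˡ-* _ _)) (sym (+-identityʳ _)))

    -- The diagonal case is the expansion along row `i`; off the diagonal the cofactors belong to a
    -- different row and the sum vanishes.
    coeff-adjugate : ∀ i l k → coeff (PolySum.sum (λ j → charMatrix M l j *ₚ PolyDet.cofactor (charMatrix M) i j)) k ≈
      (if does (l ≟ i) then coeff (charPoly M) k else 0#)
    coeff-adjugate i l k with l ≟ i
    ... | yes ≡.refl = sym (PolyDet.laplace (charMatrix M) i k)
    ... | no l≢i     = PolyDet.alienCofactors (charMatrix M) l≢i k

    -- This is the recursion behind the Faddeev-LeVerrier algorithm, read off from the coefficient
    -- of degree k + 1. Symmetry exchanges the indices of `M`, so that a product with `M` on the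
    -- right appears.
    C-step : ∀ k i l → C k i l ≈ (if does (l ≟ i) then coeff (charPoly M) (suc k) else 0#) + (C (suc k) ⊗ M) i l
    C-step k i l = begin
      C k i l
        ≈⟨ +-identityˡ _ ⟨
      0# + C k i l
        -- `S` is inserted and subtracted because `C k i l` minus `S` is exactly the coefficient
        -- that `coeff-adjugate` evaluates.
        ≈⟨ +-congʳ (-‿inverseˡ S) ⟨
      (- S + S) + C k i l
        ≈⟨ trans (+-congʳ (+-comm _ _)) (trans (+-assoc _ _ _) (+-comm _ _)) ⟩
      (- S + C k i l) + S
        ≈⟨ +-congʳ (+-cong
             (trans (-‿cong (sum-cong (λ j → trans (*-comm (C (suc k) i j) (M j l)) (*-congʳ {C (suc k) i j} (symmetric j l)))))
                    (sym (sum-neg (λ j → M l j * C (suc k) i j))))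
             (sym (sum-indicator l (C k i)))) ⟩
      (sum (λ j → - (M l j * C (suc k) i j)) + sum (λ j → if does (j ≟ l) then C k i j else 0#)) + S
        ≈⟨ +-congʳ (∑-distrib-+ (λ j → - (M l j * C (suc k) i j)) (λ j → if does (j ≟ l) then C k i j else 0#)) ⟨
      sum (λ j → - (M l j * C (suc k) i j) + (if does (j ≟ l) then C k i j else 0#)) + S
        ≈⟨ +-congʳ (sum-cong (λ j → coeff-charMatrix-* l j (PolyDet.cofactor (charMatrix M) i j) k)) ⟨
      sum (λ j → coeff (charMatrix M l j *ₚ PolyDet.cofactor (charMatrix M) i j) (suc k)) + S
        ≈⟨ +-congʳ (coeff-sum (λ j → charMatrix M l j *ₚ PolyDet.cofactor (charMatrix M) i j) (suc k)) ⟨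
      coeff (PolySum.sum (λ j → charMatrix M l j *ₚ PolyDet.cofactor (charMatrix M) i j)) (suc k) + S
        ≈⟨ +-congʳ (coeff-adjugate i l (suc k)) ⟩
      (if does (l ≟ i) then coeff (charPoly M) (suc k) else 0#) + S ∎
      where S = (C (suc k) ⊗ M) i l

    -- Only ℓ = 0 is wanted in the end. The extra power makes the induction close: unfolding `C k`
    -- produces `C (suc k)` times `M`, and that `M` is absorbed into the power.
    diagonal : ℕ → ℕ → Fin (suc n) → Carrier
    diagonal k ℓ u = (C k ⊗ (M ^ᴹ ℓ)) u u

    diagonal-step : ∀ k ℓ u → diagonal k ℓ u ≈ coeff (charPoly M) (suc k) * (M ^ᴹ ℓ) u u + diagonal (suc k) (suc ℓ) u
    diagonal-step k ℓ u = begin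
      sum (λ l → C k u l * W l)
        ≈⟨ sum-cong (λ l → trans (*-congʳ (C-step k u l)) (trans (distribʳ (W l) (δ l) (S l)) (+-congʳ (if-*ˡ (does (l ≟ u)) a (W l))))) ⟩
      sum (λ l → (if does (l ≟ u) then a * W l else 0#) + S l * W l)
        ≈⟨ ∑-distrib-+ (λ l → if does (l ≟ u) then a * W l else 0#) (λ l → S l * W l) ⟩
      sum (λ l → if does (l ≟ u) then a * W l else 0#) + sum (λ l → S l * W l)
        ≈⟨ +-cong (sum-indicator u (λ l → a * W l)) (⊗-assoc (C (suc k)) M (M ^ᴹ ℓ) u u) ⟩
      a * W u + diagonal (suc k) (suc ℓ) u ∎
      where
      a = coeff (charPoly M) (suc k)
      W S δ : Fin (suc n) → Carrier
      W l = (M ^ᴹ ℓ) l u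
      S l = (C (suc k) ⊗ M) u l
      δ l = if does (l ≟ u) then a else 0#

    diagonal-zero : ∀ k u → diagonal k 0 u ≈ C k u u
    diagonal-zero k u = trans
      (sum-cong (λ l → trans (*-comm (C k u l) (𝟙 l u))
        (trans (if-*ˡ (does (l ≟ u)) 1# (C k u l)) (if-cong (does (l ≟ u)) (*-identityˡ (C k u l))))))
      (sum-indicator u (C k u))
      where
      if-cong : ∀ b {x y} → x ≈ y → (if b then x else 0#) ≈ (if b then y else 0#)
      if-cong true  x≈y = x≈y
      if-cong false x≈y = refl

    module _ {u v} (walks : ∀ ℓ → (M ^ᴹ ℓ) u u ≈ (M ^ᴹ ℓ) v v) where

      -- Downward induction on `k` from the range where `C k` vanishes; `m` bounds the remaining
      -- distance. Each step peels off a multiple of a closed-walk count, which agrees at `u` and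
      -- `v`.
      diagonal-constant : ∀ m k ℓ → suc n ≤ m ℕ.+ k → diagonal k ℓ u ≈ diagonal k ℓ v
      diagonal-constant zero k ℓ n<k = trans (vanishes u) (sym (vanishes v))
        where
        vanishes : ∀ i → diagonal k ℓ i ≈ 0#
        vanishes i = sum-zero λ l → trans (*-congʳ (C-vanishes k n<k i l)) (zeroˡ ((M ^ᴹ ℓ) l i))
      diagonal-constant (suc m) k ℓ n<m+k = begin
        diagonal k ℓ u
          ≈⟨ diagonal-step k ℓ u ⟩
        coeff (charPoly M) (suc k) * (M ^ᴹ ℓ) u u + diagonal (suc k) (suc ℓ) u
          ≈⟨ +-cong (*-congˡ (walks ℓ)) (diagonal-constant m (suc k) (suc ℓ) (≡.subst (suc n ≤_) (≡.sym (ℕ.+-suc m k)) n<m+k)) ⟩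
        coeff (charPoly M) (suc k) * (M ^ᴹ ℓ) v v + diagonal (suc k) (suc ℓ) v
          ≈⟨ diagonal-step k ℓ v ⟨
        diagonal k ℓ v ∎

      charPoly-minor-constant : charPoly (minor M u u) ≈ₚ charPoly (minor M v v)
      charPoly-minor-constant k = begin
        coeff (charPoly (minor M u u)) k    ≈⟨ C-diagonal u ⟨
        C k u u                             ≈⟨ diagonal-zero k u ⟨
        diagonal k 0 u                      ≈⟨ diagonal-constant (suc n) k 0 (ℕ.m≤m+n (suc n) k) ⟩
        diagonal k 0 v                      ≈⟨ diagonal-zero k v ⟩
        C k v v                             ≈⟨ C-diagonal v ⟩
        coeff (charPoly (minor M v v)) k    ∎
        where
        C-diagonal : ∀ i → C k i i ≈ coeff (charPoly (minor M i i)) k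
        C-diagonal i = begin
          coeff (PolyDet.sign (toℕ i ℕ.+ toℕ i) *ₚ d) k   ≈⟨ Poly.*-congʳ {d} {PolyDet.sign (toℕ i ℕ.+ toℕ i)} {Poly.1#} (PolyDet.sign-double (toℕ i)) k ⟩
          coeff (Poly.1# *ₚ d) k                          ≈⟨ *ₚ-identityˡ d k ⟩
          coeff d k                                       ≈⟨ det-charMatrix-minor M i k ⟩
          coeff (charPoly (minor M i i)) k                ∎
          where d = PolyDet.det (PolyDet.minor (charMatrix M) i i)

-- Spectra as factorizations of characteristic polynomials

open Pseudograph
open Graph

module SpectrumProperties {c ℓ₁ ℓ₂} (K : AlgClosedFieldChar0 c ℓ₁ ℓ₂) where
  open AlgClosedFieldChar0 K using (commutativeRing; algClosed; _·_)
  open CommutativeRing commutativeRing hiding (zero)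
  open Spectrum K
  open Polynomial rawRing
  open PolynomialProperties commutativeRing
  open CharacteristicPolynomial commutativeRing
  open DeterminantProperties commutativeRing using (addEntry; border; sum-cong)
  open Determinant rawRing using (minor)
  open MatrixPower (RawRing.rawSemiring rawRing) using () renaming (_^_ to _^ᴹ_)
  open Mult semiring using (×-homo-+; ×1-homo-*)
  open Sum semiring
  open RingProperties ring using (+-cancelˡ)
  module ↭ = Permutation setoid
  open ↭ using (_↭_)
  module ℕᴹ = MatrixPower ℕ.+-*-rawSemiring

  splits : ∀ {d p} → Monic d p → ∃ λ λs → p ≈ₚ ∏[X- λs ]
  splits {zero} {p} (lead , rest) = [] , λ where
    zero    → lead
    (suc k) → rest (suc k) (s≤s z≤n)
  splits {suc d} {p} monic@(lead , rest) = x ∷ λs , p≈∏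
    where
    -- This list unfolds to the form `(a ∷ as) ++ [ 1# ]` with the arguments given to `algClosed`
    -- below, so the root found is a root of `p′` by computation.
    p′ = toMonic (coeff p) (suc d)
    p′≈p : p′ ≈ₚ p
    p′≈p = toMonic-coeff (coeff p) (suc d) lead rest
    x = proj₁ (algClosed (coeff p 0) (applyUpTo (coeff p ∘ suc) d))
    root = proj₂ (algClosed (coeff p 0) (applyUpTo (coeff p ∘ suc) d))
    quotient-splits = splits {d} {quotient x p′}
      (quotient-monic x p′ (monic-cong {p = p} {p′} (λ k → sym (p′≈p k)) monic))
    λs = proj₁ quotient-splits
    p≈∏ : p ≈ₚ ∏[X- x ∷ λs ]
    p≈∏ k = trans (sym (p′≈p k)) (trans (factor x p′ root k)
      (*ₚ-congˡ (- x ∷ 1# ∷ []) {quotient x p′} {∏[X- λs ]} (proj₂ quotient-splits) k))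

  X-cong : ∀ {x y} → x ≈ y → - x ∷ 1# ∷ [] ≈ₚ - y ∷ 1# ∷ []
  X-cong x≈y zero    = -‿cong x≈y
  X-cong x≈y (suc k) = refl

  ∏-cong-∷ : ∀ {x y xs ys} → x ≈ y → ∏[X- xs ] ≈ₚ ∏[X- ys ] → ∏[X- x ∷ xs ] ≈ₚ ∏[X- y ∷ ys ]
  ∏-cong-∷ {x} {y} {xs} {ys} x≈y xs≈ys =
    *ₚ-cong { - x ∷ 1# ∷ []} { - y ∷ 1# ∷ []} {∏[X- xs ]} {∏[X- ys ]} (X-cong x≈y) xs≈ys

  ∏-↭ : ∀ {xs ys} → xs ↭ ys → ∏[X- xs ] ≈ₚ ∏[X- ys ]
  ∏-↭ (↭.refl [])          k = refl
  ∏-↭ (↭.refl {x ∷ xs} {y ∷ ys} (x≈y ∷ eq)) = ∏-cong-∷ {xs = xs} {ys} x≈y (∏-↭ (↭.refl eq))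
  ∏-↭ (↭.prep {xs} {ys} x≈y p) = ∏-cong-∷ {xs = xs} {ys} x≈y (∏-↭ p)
  ∏-↭ (↭.swap {xs} {ys} {x} {y} {x′} {y′} x≈x′ y≈y′ p) k = begin
    coeff (∏[X- x ∷ y ∷ xs ]) k    ≈⟨ ∏-cong-∷ {xs = y ∷ xs} {y′ ∷ ys} x≈x′ (∏-cong-∷ {xs = xs} {ys} y≈y′ (∏-↭ p)) k ⟩
    coeff (l x′ *ₚ (l y′ *ₚ q)) k  ≈⟨ *ₚ-assoc (l x′) (l y′) q k ⟨
    coeff ((l x′ *ₚ l y′) *ₚ q) k  ≈⟨ *ₚ-cong {l x′ *ₚ l y′} {l y′ *ₚ l x′} {q} {q} (*ₚ-comm (l x′) (l y′)) (λ _ → refl) k ⟩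
    coeff ((l y′ *ₚ l x′) *ₚ q) k  ≈⟨ *ₚ-assoc (l y′) (l x′) q k ⟩
    coeff (l y′ *ₚ (l x′ *ₚ q)) k  ∎
    where
    open SetoidReasoning setoid
    l : Carrier → Poly
    l x = - x ∷ 1# ∷ []
    q = ∏[X- ys ]
  ∏-↭ (↭.trans p q)        k = trans (∏-↭ p k) (∏-↭ q k)

  A : ∀ {n} → Pseudograph n → Matrix Carrier n
  A P i j = mult P i j · 1#

  -- For the converse, one factorization of the polynomial of `Q` serves as the spectrum of both,
  -- related by the identity permutation.
  sameSpectrum⇔charPoly : ∀ {m n} (P : Pseudograph m) (Q : Pseudograph n) →
    SameSpectrum P Q ⇔ (charPoly (A P) ≈ₚ charPoly (A Q))
  sameSpectrum⇔charPoly P Q = mk⇔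
    (λ { (λs , μs , P≈ , Q≈ , λs↭μs) k → trans (P≈ k) (trans (∏-↭ λs↭μs k) (sym (Q≈ k))) })
    λ P≈Q → let λs , Q≈ = splits {p = charPoly (A Q)} (charPoly-monic (A Q)) in
      λs , λs , (λ k → trans (P≈Q k) (Q≈ k)) , Q≈ , ↭.↭-refl

  -- Adjacency matrices carried from the natural numbers into the field

  if-· : ∀ b → (if b then 1 else 0) · 1# ≈ (if b then 1# else 0#)
  if-· true  = +-identityʳ 1#
  if-· false = refl

  sum-· : ∀ {n} (f : Fin n → ℕ) → RawSemiringDefs.sum ℕ.+-*-rawSemiring f · 1# ≈ sum (λ i → f i · 1#)
  sum-· {zero}  f = refl
  sum-· {suc n} f = trans (×-homo-+ 1# (f zero) _) (+-congˡ (sum-· (f ∘ suc)))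

  -- Walk-regularity counts walks in the natural numbers. Since n ↦ n · 1 is a homomorphism of
  -- semirings, it commutes with matrix powers and transfers the hypothesis to the field.
  ^-· : ∀ {n} (M : Matrix ℕ n) ℓ i j → (M ℕᴹ.^ ℓ) i j · 1# ≈ ((λ k l → M k l · 1#) ^ᴹ ℓ) i j
  ^-· M zero    i j = if-· (does (i ≟ j))
  ^-· M (suc ℓ) i j = trans (sum-· (λ k → M i k ℕ.* (M ℕᴹ.^ ℓ) k j))
    (sum-cong (λ k → trans (×1-homo-* (M i k) ((M ℕᴹ.^ ℓ) k j)) (*-congˡ (^-· M ℓ k j))))

  A-loops : ∀ {n} (G : Graph n) u v i j → A (addLoops₂ G u v) i j ≈ addEntry (addEntry (A ⟦ G ⟧) u u 1#) v v 1# i j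
  A-loops G u v i j = trans (loop (⟦ G ⟧ +loop u) v) (+-congʳ (loop ⟦ G ⟧ u))
    where
    loop : ∀ P u → A (P +loop u) i j ≈ addEntry (A P) u u 1# i j
    loop P u = trans (×-homo-+ 1# (mult P i j) _) (+-congˡ (if-· (does (i ≟ u) ∧ does (j ≟ u))))

  A-pendant : ∀ {n} (G : Graph n) u i j → A ⟦ G +pendant u ⟧ i j ≈ border 0# 1# u (A ⟦ G ⟧) i j
  A-pendant G u zero    zero    = refl
  A-pendant G u zero    (suc j) = if-· (does (j ≟ u))
  A-pendant G u (suc i) zero    = if-· (does (i ≟ u))
  A-pendant G u (suc i) (suc j) = refl

  A-pendants : ∀ {n} (G : Graph n) u v i j →
    A ⟦ addPendants₂ G u v ⟧ i j ≈ border 0# 1# (suc v) (border 0# 1# u (A ⟦ G ⟧)) i j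
  A-pendants G u v i j = trans (A-pendant (G +pendant u) (suc v) i j) (inner i j)
    where
    inner : ∀ i j → border 0# 1# (suc v) (A ⟦ G +pendant u ⟧) i j ≈ border 0# 1# (suc v) (border 0# 1# u (A ⟦ G ⟧)) i j
    inner zero    zero    = refl
    inner zero    (suc j) = refl
    inner (suc i) zero    = refl
    inner (suc i) (suc j) = A-pendant G u i j

  cancel⇔ : ∀ {p q r s a b} → p ≈ₚ r Poly.+ a → q ≈ₚ s Poly.+ b → r ≈ₚ s → (p ≈ₚ q) ⇔ (a ≈ₚ b)
  cancel⇔ {p} {q} {r} {s} {a} {b} p≈ q≈ r≈s = mk⇔
    (λ p≈q k → +-cancelˡ (coeff r k) _ _ (begin
      coeff r k + coeff a k     ≈⟨ coeff-+ r a k ⟨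
      coeff (r Poly.+ a) k      ≈⟨ p≈ k ⟨
      coeff p k                 ≈⟨ p≈q k ⟩
      coeff q k                 ≈⟨ q≈ k ⟩
      coeff (s Poly.+ b) k      ≈⟨ coeff-+ s b k ⟩
      coeff s k + coeff b k     ≈⟨ +-congʳ (r≈s k) ⟨
      coeff r k + coeff b k     ∎))
    λ a≈b k → begin
      coeff p k                 ≈⟨ p≈ k ⟩
      coeff (r Poly.+ a) k      ≈⟨ +ₚ-cong {r} {s} {a} {b} r≈s a≈b k ⟩
      coeff (s Poly.+ b) k      ≈⟨ q≈ k ⟨
      coeff q k                 ∎
    where open SetoidReasoning setoid

  -- The equivalences for a walk-regular graph

  module _ {n} (G : Graph (suc (suc n))) (walkRegular : WalkRegular G)
           (u v w z : Fin (suc (suc n))) (u≢v : u ≢ v) (w≢z : w ≢ z) where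

    private
      M = A ⟦ G ⟧
      φ = charPoly M

      φ₁ : Fin (suc (suc n)) → Poly
      φ₁ i = charPoly (minor M i i)

      φ₁-constant : ∀ i j → φ₁ i ≈ₚ φ₁ j
      φ₁-constant i j = charPoly-minor-constant M
        (λ k l → reflexive (≡.cong (_· 1#) (mult-sym ⟦ G ⟧ k l)))
        (λ ℓ → trans (sym (^-· (mult ⟦ G ⟧) ℓ i i))
          (trans (reflexive (≡.cong (_· 1#) (walkRegular ℓ i j))) (^-· (mult ⟦ G ⟧) ℓ j j)))

      rest-loops rest-pendants : Fin (suc (suc n)) → Fin (suc (suc n)) → Poly
      rest-loops    i j = (φ Poly.- φ₁ i) Poly.- φ₁ j
      rest-pendants i j = X *ₚ (X *ₚ φ Poly.- φ₁ i) Poly.- X *ₚ φ₁ j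

      sub-cong : ∀ {p q r s} → p ≈ₚ q → r ≈ₚ s → p Poly.- r ≈ₚ q Poly.- s
      sub-cong {p} {q} {r} {s} p≈q r≈s = Poly.+-cong {p} {q} {Poly.- r} {Poly.- s} p≈q (Poly.-‿cong {r} {s} r≈s)

      rest-loops-constant : rest-loops u v ≈ₚ rest-loops w z
      rest-loops-constant = sub-cong {φ Poly.- φ₁ u} {φ Poly.- φ₁ w} {φ₁ v} {φ₁ z}
        (sub-cong {φ} {φ} {φ₁ u} {φ₁ w} (λ _ → refl) (φ₁-constant u w)) (φ₁-constant v z)

      rest-pendants-constant : rest-pendants u v ≈ₚ rest-pendants w z
      rest-pendants-constant = sub-cong
        {X *ₚ (X *ₚ φ Poly.- φ₁ u)} {X *ₚ (X *ₚ φ Poly.- φ₁ w)} {X *ₚ φ₁ v} {X *ₚ φ₁ z}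
        (*ₚ-congˡ X {X *ₚ φ Poly.- φ₁ u} {X *ₚ φ Poly.- φ₁ w}
          (sub-cong {X *ₚ φ} {X *ₚ φ} {φ₁ u} {φ₁ w} (λ _ → refl) (φ₁-constant u w)))
        (*ₚ-congˡ X {φ₁ v} {φ₁ z} (φ₁-constant v z))

      -- The adjacency matrix of `delete₂` is the twofold minor of `M` by computation, so only the
      -- side with the loops has to be rewritten.
      loops : ∀ {i j} (i≢j : i ≢ j) →
        charPoly (A (addLoops₂ G i j)) ≈ₚ rest-loops i j Poly.+ charPoly (A ⟦ delete₂ G i j i≢j ⟧)
      loops {i} {j} i≢j k = trans (charPoly-cong {M = A (addLoops₂ G i j)} (A-loops G i j) k) (charPoly-loops M i≢j k)

      pendants : ∀ {i j} (i≢j : i ≢ j) →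
        charPoly (A ⟦ addPendants₂ G i j ⟧) ≈ₚ rest-pendants i j Poly.+ charPoly (A ⟦ delete₂ G i j i≢j ⟧)
      pendants {i} {j} i≢j k = trans (charPoly-cong {M = A ⟦ addPendants₂ G i j ⟧} (A-pendants G i j) k) (charPoly-pendants M i≢j k)

    loops⇔delete : SameSpectrum (addLoops₂ G u v) (addLoops₂ G w z) ⇔
                   SameSpectrum ⟦ delete₂ G u v u≢v ⟧ ⟦ delete₂ G w z w≢z ⟧
    loops⇔delete =
      ⇔-sym (sameSpectrum⇔charPoly ⟦ delete₂ G u v u≢v ⟧ ⟦ delete₂ G w z w≢z ⟧)
      ⇔-∘ (cancel⇔ {charPoly (A (addLoops₂ G u v))} {charPoly (A (addLoops₂ G w z))} {rest-loops u v} {rest-loops w z}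
            (loops u≢v) (loops w≢z) rest-loops-constant
      ⇔-∘ sameSpectrum⇔charPoly (addLoops₂ G u v) (addLoops₂ G w z))

    pendants⇔delete : SameSpectrum ⟦ addPendants₂ G u v ⟧ ⟦ addPendants₂ G w z ⟧ ⇔
                      SameSpectrum ⟦ delete₂ G u v u≢v ⟧ ⟦ delete₂ G w z w≢z ⟧
    pendants⇔delete =
      ⇔-sym (sameSpectrum⇔charPoly ⟦ delete₂ G u v u≢v ⟧ ⟦ delete₂ G w z w≢z ⟧)
      ⇔-∘ (cancel⇔ {charPoly (A ⟦ addPendants₂ G u v ⟧)} {charPoly (A ⟦ addPendants₂ G w z ⟧)} {rest-pendants u v} {rest-pendants w z}
            (pendants u≢v) (pendants w≢z) rest-pendants-constant
      ⇔-∘ sameSpectrum⇔charPoly ⟦ addPendants₂ G u v ⟧ ⟦ addPendants₂ G w z ⟧)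

lemma4p1 : ∀ {c ℓ₁ ℓ₂} (K : AlgClosedFieldChar0 c ℓ₁ ℓ₂) →
    let open Spectrum K in
    ∀ {n : ℕ} (G : Graph n) → Connected G → WalkRegular G →
    ∀ (u v w z : Fin n) (u≢v : u ≢ v) (w≢z : w ≢ z) →
    let
      a = SameSpectrum ⟦ delete₂ G u v u≢v ⟧ ⟦ delete₂ G w z w≢z ⟧
      b = SameSpectrum (addLoops₂ G u v) (addLoops₂ G w z)
      c = SameSpectrum ⟦ addPendants₂ G u v ⟧ ⟦ addPendants₂ G w z ⟧
    in (a ⇔ b) × (b ⇔ c)
-- Two distinct vertices force at least two vertices, the size at which twofold minors make sense.
lemma4p1 K {suc zero} G _ _ zero zero w z u≢v w≢z = contradiction ≡.refl u≢v
lemma4p1 K {suc (suc n)} G _ walkRegular u v w z u≢v w≢z =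
  ⇔-sym b⇔a , ⇔-sym c⇔a ⇔-∘ b⇔a
  where
  open SpectrumProperties K
  b⇔a = loops⇔delete G walkRegular u v w z u≢v w≢z
  c⇔a = pendants⇔delete G walkRegular u v w z u≢v w≢z
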